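{- Let $P$ be a finite hereditary permutator, let $\sigma,\tau$ be types with disjunctive weak normal forms $w(\sigma)=\bigvee_{i\in I}\mu_i$ and $w(\tau)=\bigvee_{j\in J}\nu_j$, where the $\mu_i,\nu_j$ are basic intersections. If $\vdash P:\sigma\to\tau$, then for every $i\in I$ there is $j_i\in J$ such that $\vdash P:\mu_i\to\nu_{j_i}$.
   Context: Types: $\sigma ::= \varphi \mid \sigma\to\sigma \mid \sigma\wedge\sigma \mid \sigma\vee\sigma$ ($\varphi$ atomic). A basic type is an atomic or arrow type; a basic intersection is a finite intersection of basic types; at top level $\wedge,\vee$ are taken modulo associativity, commutativity, idempotence. The disjunctive weak normal form $w(\sigma)$ is obtained by applying $(\sigma\vee\tau)\wedge\rho\mapsto(\sigma\wedge\rho)\vee(\tau\wedge\rho)$ at top level (not under arrows) as far as possible: $w(\alpha)=\alpha$ for basic $\alpha$, $w(\sigma\vee\tau)=w(\sigma)\vee w(\tau)$, and if $w(\sigma)=\bigvee_i\mu_i$, $w(\tau)=\bigvee_j\nu_j$ then $w(\sigma\wedge\tau)=\bigvee_{i,j}(\mu_i\wedge\nu_j)$. Typing of linear $\lambda$-terms (each variable occurs exactly once): (Ax) $x:\sigma\vdash x:\sigma$; ($\to$I) from $\Gamma,x:\sigma\vdash M:\tau$ infer $\Gamma\vdash\lambda x.M:\sigma\to\tau$; ($\to$E) from $\Gamma_1\vdash M:\sigma\to\tau$, $\Gamma_2\vdash N:\sigma$ infer $\Gamma_1,\Gamma_2\vdash MN:\tau$; ($\wedge$I) from $\Gamma\vdash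 M:\sigma$, $\Gamma\vdash M:\tau$ infer $\Gamma\vdash M:\sigma\wedge\tau$; ($\wedge$E) from $\Gamma\vdash M:\sigma\wedge\tau$ infer $\Gamma\vdash M:\sigma$ and $\Gamma\vdash M:\tau$; ($\vee$I) from $\Gamma\vdash M:\sigma$ infer $\Gamma\vdash M:\sigma\vee\tau$ and $\Gamma\vdash M:\tau\vee\sigma$; ($\vee$E) from $\Gamma_1,x:\sigma\wedge\theta\vdash M:\rho$, $\Gamma_1,x:\tau\wedge\theta\vdash M:\rho$, $\Gamma_2\vdash N:(\sigma\vee\tau)\wedge\theta$ infer $\Gamma_1,\Gamma_2\vdash M[N/x]:\rho$. Environments are finite sets of $x:\sigma$ with distinct variables; $\Gamma_1,\Gamma_2$ requires disjoint variables. A finite hereditary permutator is a $\lambda$-term which modulo $\beta$-conversion has the form $\lambda xy_1\dots y_n.x(P_1y_{\pi(1)})\dots(P_ny_{\pi(n)})$ ($n\ge0$) with $\pi$ a permutation of $1,\dots,n$ and $P_1,\dots,P_n$ finite hereditary permutators. -}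

module Defs where

open import Data.Nat using (ℕ; zero; suc; _+_; _∸_; _≡ᵇ_)
open import Data.Bool using (if_then_else_)
open import Data.Maybe using (Maybe; just; nothing)
open import Data.Fin using (Fin; toℕ)
open import Data.Fin.Permutation using (Permutation′; _⟨$⟩ʳ_)
open import Data.List using (List; []; _∷_; _++_; map; concatMap; foldl; allFin)
open import Data.List.NonEmpty using (List⁺; [_]; foldr₁) renaming (_⁺++⁺_ to _++⁺_)
open import Data.Product using (_×_)
open import Data.Sum using (_⊎_)
open import Relation.Binary.PropositionalEquality using (_≡_; _≢_)

infixr 7 _⇒_
infixl 8 _∧_
infixl 8 _∨_

data Ty : Set where
  atom : ℕ → Ty
  _⇒_  : Ty → Ty → Ty
  _∧_  : Ty → Ty → Ty
  _∨_  : Ty → Ty → Ty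

-- A basic intersection is represented by the non-empty list of its basic
-- types; the disjunctive weak normal form by the list of its disjuncts.
-- (∧, ∨ at top level are modulo ACI; lists are concrete representatives.)
BasicInter : Set
BasicInter = List⁺ Ty

w : Ty → List BasicInter
w (atom a)  = [ atom a ] ∷ []
w (σ ⇒ τ)   = [ σ ⇒ τ ] ∷ []
w (σ ∨ τ)   = w σ ++ w τ
w (σ ∧ τ)   = concatMap (λ μ → map (λ ν → μ ++⁺ ν) (w τ)) (w σ)

⋀ : BasicInter → Ty
⋀ = foldr₁ _∧_

data Tm : Set where
  var : ℕ → Tm
  lam : Tm → Tm
  app : Tm → Tm → Tm

Ren : Set
Ren = ℕ → ℕ

Sub : Set
Sub = ℕ → Tm

extR : Ren → Ren
extR ρ zero    = zero
extR ρ (suc k) = suc (ρ k)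

rename : Ren → Tm → Tm
rename ρ (var k)   = var (ρ k)
rename ρ (lam M)   = lam (rename (extR ρ) M)
rename ρ (app M N) = app (rename ρ M) (rename ρ N)

extS : Sub → Sub
extS s zero    = var zero
extS s (suc k) = rename suc (s k)

subst : Sub → Tm → Tm
subst s (var k)   = s k
subst s (lam M)   = lam (subst (extS s) M)
subst s (app M N) = app (subst s M) (subst s N)

-- M[N/x] : replace the free variable x by N (no other variable changes,
-- exactly as in the named presentation; capture-avoidance is automatic)
_[_/_] : Tm → Tm → ℕ → Tm
M [ N / x ] = subst (λ k → if k ≡ᵇ x then N else var k) M

β-sub : Tm → Sub
β-sub N zero    = N
β-sub N (suc k) = var k

infix 4 _→β_ _=β_

data _→β_ : Tm → Tm → Set where
  β    : ∀ {M N} → app (lam M) N →β subst (β-sub N) M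
  ξlam : ∀ {M M'} → M →β M' → lam M →β lam M'
  ξappˡ : ∀ {M M' N} → M →β M' → app M N →β app M' N
  ξappʳ : ∀ {M N N'} → N →β N' → app M N →β app M N'

data _=β_ : Tm → Tm → Set where
  step  : ∀ {M N} → M →β N → M =β N
  refl  : ∀ {M} → M =β M
  sym   : ∀ {M N} → M =β N → N =β M
  trans : ∀ {M N L} → M =β N → N =β L → M =β L

lams : ℕ → Tm → Tm
lams zero    M = M
lams (suc n) M = lams n (lam M)

-- the term  λ x y₁ … yₙ . x (P₁ y_{π(1)}) … (Pₙ y_{π(n)})
-- (x = var n, y_{j+1} = var (n ∸ suc j) under the n+1 binders;
--  the Pᵢ are shifted past the n+1 binders)
permShape : (n : ℕ) → Permutation′ n → (Fin n → Tm) → Tm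
permShape n π Ps =
  lams (suc n)
    (foldl app (var n)
      (map (λ i → app (rename (_+ suc n) (Ps i))
                      (var (n ∸ suc (toℕ (π ⟨$⟩ʳ i)))))
           (allFin n)))

data FHP : Tm → Set where
  fhp : ∀ {M} (n : ℕ) (π : Permutation′ n) (Ps : Fin n → Tm) →
        (∀ i → FHP (Ps i)) → M =β permShape n π Ps → FHP M

Env : Set
Env = ℕ → Maybe Ty

∅ : Env
∅ _ = nothing

_∷ₑ_ : Ty → Env → Env
(σ ∷ₑ Γ) zero    = just σ
(σ ∷ₑ Γ) (suc k) = Γ k

_[_≔_] : Env → ℕ → Ty → Env
(Γ [ x ≔ σ ]) k = if k ≡ᵇ x then just σ else Γ k

Split : Env → Env → Env → Set
Split Γ Γ₁ Γ₂ = ∀ k → (Γ₁ k ≡ nothing × Γ k ≡ Γ₂ k) ⊎ (Γ₂ k ≡ nothing × Γ k ≡ Γ₁ k)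

infix 3 _⊢_∶_

data _⊢_∶_ : Env → Tm → Ty → Set where
  ax  : ∀ {Γ x σ} → Γ x ≡ just σ → (∀ k → k ≢ x → Γ k ≡ nothing) →
        Γ ⊢ var x ∶ σ
  ⇒I  : ∀ {Γ M σ τ} → σ ∷ₑ Γ ⊢ M ∶ τ → Γ ⊢ lam M ∶ σ ⇒ τ
  ⇒E  : ∀ {Γ Γ₁ Γ₂ M N σ τ} → Split Γ Γ₁ Γ₂ →
        Γ₁ ⊢ M ∶ σ ⇒ τ → Γ₂ ⊢ N ∶ σ → Γ ⊢ app M N ∶ τ
  ∧I  : ∀ {Γ M σ τ} → Γ ⊢ M ∶ σ → Γ ⊢ M ∶ τ → Γ ⊢ M ∶ σ ∧ τ
  ∧E₁ : ∀ {Γ M σ τ} → Γ ⊢ M ∶ σ ∧ τ → Γ ⊢ M ∶ σ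
  ∧E₂ : ∀ {Γ M σ τ} → Γ ⊢ M ∶ σ ∧ τ → Γ ⊢ M ∶ τ
  ∨I₁ : ∀ {Γ M σ τ} → Γ ⊢ M ∶ σ → Γ ⊢ M ∶ σ ∨ τ
  ∨I₂ : ∀ {Γ M σ τ} → Γ ⊢ M ∶ σ → Γ ⊢ M ∶ τ ∨ σ
  ∨E  : ∀ {Γ Γ₁ Γ₂ x M N σ τ θ ρ} → Γ₁ x ≡ nothing → Split Γ Γ₁ Γ₂ →
        Γ₁ [ x ≔ σ ∧ θ ] ⊢ M ∶ ρ → Γ₁ [ x ≔ τ ∧ θ ] ⊢ M ∶ ρ →
        Γ₂ ⊢ N ∶ (σ ∨ τ) ∧ θ → Γ ⊢ M [ N / x ] ∶ ρ

{-# OPTIONS --safe #-}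
module Submission where

-- The system has no subject expansion: contracting (λz. f z w) b below λw exposes f b, whose
-- union type can then be eliminated outside λw.  So P cannot be replaced by its normal form,
-- and the proof works with P itself, run as a closure with delayed substitutions.  Types are
-- realized by closures, ∧ by a product and ∨ by a disjoint sum; a realizer also carries a
-- typing of every delayed piece, which survives expansion steps of the machine.  Applied to
-- a variable x : μᵢ, the closure P realizes τ, hence some disjunct νⱼ, and the typings it
-- carries assemble to ⊢ P : μᵢ → νⱼ.
-- The variable x is a realizer of μᵢ only if no closure x N is ever evaluated outside the
-- binders y₁ … yₙ.  To see this, replace x by λe.Z: then x N converts to the λI-term Z, while
-- the permutator converts to λy₁ … yₙ. Z (P₂ y_{π(2)}) … (Pₙ y_{π(n)}), in which y_{π(1)} is
-- lost (or, if n = 0, to λe.Z, which loses e).  As every other part of the closure is a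
-- λI-term, this contradicts confluence and the preservation of λI-terms by reduction.

open import Defs
open import Data.List.Membership.Propositional using (_∈_)
open import Data.Product using (Σ; _×_)

open import Data.Bool using (Bool; true; false; if_then_else_; not; T) renaming (_∧_ to _&_)
open import Data.Bool.Properties using (∧-zeroʳ)
open import Data.Empty using (⊥; ⊥-elim)
open import Data.Fin using (Fin; zero; suc; toℕ)
open import Data.Fin.Permutation using (_⟨$⟩ʳ_; _⟨$⟩ˡ_; inverseˡ)
open import Data.Fin.Properties using (toℕ-injective; toℕ<n)
open import Data.List using (List; []; _∷_; map; foldl; tabulate)
open import Data.List.Membership.Propositional using (find; lose)
open import Data.List.Membership.Propositional.Properties
  using (∈-concatMap⁺; ∈-concatMap⁻; ∈-map⁺; ∈-map⁻; ∈-++⁺ˡ; ∈-++⁺ʳ; ∈-++⁻)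
open import Data.List.NonEmpty using (_∷_; _⁺++⁺_)
open import Data.List.Relation.Unary.Any using (Any; here; there)
open import Data.List.Relation.Unary.Any.Properties using (map⁻; tabulate⁻)
open import Data.Maybe as Maybe using (Maybe; just; nothing; is-just; maybe)
open import Data.Maybe.Properties using (just-injective)
open import Data.Nat using (ℕ; zero; suc; _+_; _∸_; _≤_; _<_; _⊔_; _≡ᵇ_; s≤s)
import Data.Nat.Properties as ℕ
open import Data.Product using (∃; _,_; proj₁; proj₂; map₂)
open import Data.Sum using (_⊎_; inj₁; inj₂)
open import Function using (_∘_; id)
open import Relation.Binary.Construct.Closure.ReflexiveTransitive using (Star; ε; _◅_; _◅◅_)
open import Relation.Binary.PropositionalEquality as Eq using (_≡_; _≢_; _≗_; refl; cong; cong₂)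
open import Relation.Nullary using (¬_; yes; no)
open import Relation.Nullary.Decidable using (dec-true; dec-false)

-- Renaming and substitution

data _∈FV_ : ℕ → Tm → Set where
  here  : ∀ {k} → k ∈FV var k
  under : ∀ {k M} → suc k ∈FV M → k ∈FV lam M
  left  : ∀ {k M N} → k ∈FV M → k ∈FV app M N
  right : ∀ {k M N} → k ∈FV N → k ∈FV app M N

subst-cong : ∀ {s t} M → (∀ {k} → k ∈FV M → s k ≡ t k) → subst s M ≡ subst t M
subst-cong (var k) h = h here
subst-cong (lam M) h = cong lam
  (subst-cong M λ { {zero} _ → refl ; {suc k} p → cong (rename suc) (h (under p)) })
subst-cong (app M N) h = cong₂ app (subst-cong M (h ∘ left)) (subst-cong N (h ∘ right))

subst-ext : ∀ {s t} M → (∀ k → s k ≡ t k) → subst s M ≡ subst t M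
subst-ext M h = subst-cong M (λ {k} _ → h k)

subst-rename : ∀ {s ρ} M → subst s (rename ρ M) ≡ subst (s ∘ ρ) M
subst-rename (var k)   = refl
subst-rename (lam M)   = cong lam (Eq.trans (subst-rename M) (subst-ext M λ where
  zero    → refl
  (suc k) → refl))
subst-rename (app M N) = cong₂ app (subst-rename M) (subst-rename N)

rename≡subst : ∀ {ρ} M → rename ρ M ≡ subst (var ∘ ρ) M
rename≡subst (var k)   = refl
rename≡subst (lam M)   = cong lam (Eq.trans (rename≡subst M) (subst-ext M λ where
  zero    → refl
  (suc k) → refl))
rename≡subst (app M N) = cong₂ app (rename≡subst M) (rename≡subst N)

rename-rename : ∀ {ρ ρ'} M → rename ρ (rename ρ' M) ≡ rename (ρ ∘ ρ') M
rename-rename M =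
  Eq.trans (rename≡subst (rename _ M)) (Eq.trans (subst-rename M) (Eq.sym (rename≡subst M)))

rename-subst : ∀ {ρ s} M → rename ρ (subst s M) ≡ subst (rename ρ ∘ s) M
rename-subst (var k)   = refl
rename-subst {s = s} (lam M) = cong lam (Eq.trans (rename-subst M) (subst-ext M λ where
  zero    → refl
  (suc k) → Eq.trans (rename-rename (s k)) (Eq.sym (rename-rename (s k)))))
rename-subst (app M N) = cong₂ app (rename-subst M) (rename-subst N)

subst-subst : ∀ {s t} M → subst s (subst t M) ≡ subst (subst s ∘ t) M
subst-subst (var k)   = refl
subst-subst {t = t} (lam M) = cong lam (Eq.trans (subst-subst M) (subst-ext M λ where
  zero    → refl
  (suc k) → Eq.trans (subst-rename (t k)) (Eq.sym (rename-subst (t k)))))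
subst-subst (app M N) = cong₂ app (subst-subst M) (subst-subst N)

subst-var : ∀ M → subst var M ≡ M
subst-var (var k)   = refl
subst-var (lam M)   = cong lam (Eq.trans (subst-ext M λ where
  zero    → refl
  (suc k) → refl) (subst-var M))
subst-var (app M N) = cong₂ app (subst-var M) (subst-var N)

subst-id : ∀ {s} M → (∀ {k} → k ∈FV M → s k ≡ var k) → subst s M ≡ M
subst-id M h = Eq.trans (subst-cong M h) (subst-var M)

infixr 5 _◂_

_◂_ : ∀ {A : Set} → A → (ℕ → A) → ℕ → A
(a ◂ s) zero    = a
(a ◂ s) (suc k) = s k

subst-β-extS : ∀ {s N} M → subst (β-sub N) (subst (extS s) M) ≡ subst (N ◂ s) M
subst-β-extS {s} M = Eq.trans (subst-subst M) (subst-ext M λ where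
  zero    → refl
  (suc k) → Eq.trans (subst-rename (s k)) (subst-var (s k)))

subst-β : ∀ {s N} M → subst s (subst (β-sub N) M) ≡ subst (β-sub (subst s N)) (subst (extS s) M)
subst-β {s} {N} M = Eq.trans
  (Eq.trans (subst-subst M) (subst-ext M λ where
    zero    → refl
    (suc k) → refl))
  (Eq.sym (subst-β-extS M))

rename-β : ∀ {ρ N} M →
  rename ρ (subst (β-sub N) M) ≡ subst (β-sub (rename ρ N)) (rename (extR ρ) M)
rename-β M = Eq.trans
  (Eq.trans (rename-subst M) (subst-ext M λ where
    zero    → refl
    (suc k) → refl))
  (Eq.sym (subst-rename M))

∈FV-rename⁻ : ∀ {k ρ} M → k ∈FV rename ρ M → ∃ λ j → j ∈FV M × ρ j ≡ k
∈FV-rename⁻ (var j) here = j , here , refl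
∈FV-rename⁻ (lam M) (under p) with ∈FV-rename⁻ M p
... | suc j , q , refl = j , under q , refl
∈FV-rename⁻ (app M N) (left p)  = map₂ (λ (q , e) → left q , e) (∈FV-rename⁻ M p)
∈FV-rename⁻ (app M N) (right p) = map₂ (λ (q , e) → right q , e) (∈FV-rename⁻ N p)

∈FV-rename⁺ : ∀ {k ρ M} → k ∈FV M → ρ k ∈FV rename ρ M
∈FV-rename⁺ here      = here
∈FV-rename⁺ (under p) = under (∈FV-rename⁺ p)
∈FV-rename⁺ (left p)  = left (∈FV-rename⁺ p)
∈FV-rename⁺ (right p) = right (∈FV-rename⁺ p)

∈FV-subst⁻ : ∀ {k s} M → k ∈FV subst s M → ∃ λ j → j ∈FV M × k ∈FV s j
∈FV-subst⁻ (var j) p = j , here , p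
∈FV-subst⁻ {s = s} (lam M) (under p) with ∈FV-subst⁻ M p
... | suc j , q , r with ∈FV-rename⁻ (s j) r
...   | _ , r' , refl = j , under q , r'
∈FV-subst⁻ (app M N) (left p)  = map₂ (λ (q , r) → left q , r) (∈FV-subst⁻ M p)
∈FV-subst⁻ (app M N) (right p) = map₂ (λ (q , r) → right q , r) (∈FV-subst⁻ N p)

∈FV-subst⁺ : ∀ {j k s M} → j ∈FV M → k ∈FV s j → k ∈FV subst s M
∈FV-subst⁺ here      r = r
∈FV-subst⁺ (under p) r = under (∈FV-subst⁺ p (∈FV-rename⁺ r))
∈FV-subst⁺ (left p)  r = left (∈FV-subst⁺ p r)
∈FV-subst⁺ (right p) r = right (∈FV-subst⁺ p r)

FV-bound : ∀ M → ∃ λ n → ∀ {k} → k ∈FV M → k < n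
FV-bound (var k) = suc k , λ { here → ℕ.≤-refl }
FV-bound (lam M) with FV-bound M
... | n , h = n , λ { (under p) → ℕ.<⇒≤ (h p) }
FV-bound (app M N) with FV-bound M | FV-bound N
... | m , g | n , h = m ⊔ n , λ where
  (left p)  → ℕ.≤-trans (g p) (ℕ.m≤m⊔n m n)
  (right p) → ℕ.≤-trans (h p) (ℕ.m≤n⊔m m n)

common-bound : ∀ (s : Sub) n → ∃ λ m → ∀ {k} → k < n → ∀ {j} → j ∈FV s k → j < m
common-bound s zero = zero , λ ()
common-bound s (suc n) with common-bound s n | FV-bound (s n)
... | m , g | l , h = m ⊔ l , bounds
  where
  bounds : ∀ {k} → k < suc n → ∀ {j} → j ∈FV s k → j < m ⊔ l
  bounds {k} (s≤s k≤n) p with k ℕ.≟ n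
  ... | yes refl = ℕ.≤-trans (h p) (ℕ.m≤n⊔m m l)
  ... | no k≢n   = ℕ.≤-trans (g (ℕ.≤∧≢⇒< k≤n k≢n) p) (ℕ.m≤m⊔n m l)

-- Needed because `∨E` acts on a named free variable, not on a de Bruijn binder: the substitution
-- lemma has to move that variable out of the way of the images of `s`.
fresh : ∀ (s : Sub) M → ∃ λ z → ∀ {k} → k ∈FV M → ¬ z ∈FV s k
fresh s M with FV-bound M
... | n , h with common-bound s n
...   | z , g = z , λ p q → ℕ.<-irrefl refl (g (h p) q)

-- Confluence and λI-terms

infix 4 _⇛_

data _⇛_ : Tm → Tm → Set where
  var : ∀ {k} → var k ⇛ var k
  lam : ∀ {M M'} → M ⇛ M' → lam M ⇛ lam M'
  app : ∀ {M M' N N'} → M ⇛ M' → N ⇛ N' → app M N ⇛ app M' N'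
  β   : ∀ {M M' N N'} → M ⇛ M' → N ⇛ N' → app (lam M) N ⇛ subst (β-sub N') M'

⇛-refl : ∀ {M} → M ⇛ M
⇛-refl {var k}   = var
⇛-refl {lam M}   = lam ⇛-refl
⇛-refl {app M N} = app ⇛-refl ⇛-refl

→β⇒⇛ : ∀ {M N} → M →β N → M ⇛ N
→β⇒⇛ β         = β ⇛-refl ⇛-refl
→β⇒⇛ (ξlam r)  = lam (→β⇒⇛ r)
→β⇒⇛ (ξappˡ r) = app (→β⇒⇛ r) ⇛-refl
→β⇒⇛ (ξappʳ r) = app ⇛-refl (→β⇒⇛ r)

⇛-rename : ∀ {M M'} ρ → M ⇛ M' → rename ρ M ⇛ rename ρ M'
⇛-rename ρ var       = var
⇛-rename ρ (lam r)   = lam (⇛-rename (extR ρ) r)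
⇛-rename ρ (app r t) = app (⇛-rename ρ r) (⇛-rename ρ t)
⇛-rename ρ (β {M' = M'} {N' = N'} r t) =
  Eq.subst (_ ⇛_) (Eq.sym (rename-β M')) (β (⇛-rename (extR ρ) r) (⇛-rename ρ t))

⇛-subst : ∀ {M M' s s'} → (∀ k → s k ⇛ s' k) → M ⇛ M' → subst s M ⇛ subst s' M'
⇛-extS : ∀ {s s'} → (∀ k → s k ⇛ s' k) → ∀ k → extS s k ⇛ extS s' k

⇛-subst h var       = h _
⇛-subst h (lam r)   = lam (⇛-subst (⇛-extS h) r)
⇛-subst h (app r t) = app (⇛-subst h r) (⇛-subst h t)
⇛-subst h (β {M' = M'} r t) =
  Eq.subst (_ ⇛_) (Eq.sym (subst-β M')) (β (⇛-subst (⇛-extS h) r) (⇛-subst h t))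

⇛-extS h zero    = var
⇛-extS h (suc k) = ⇛-rename suc (h k)

⇛-β-sub : ∀ {N N'} → N ⇛ N' → ∀ k → β-sub N k ⇛ β-sub N' k
⇛-β-sub r zero    = r
⇛-β-sub r (suc k) = var

develop : Tm → Tm
develop (var k)             = var k
develop (lam M)             = lam (develop M)
develop (app (var k) N)     = app (var k) (develop N)
develop (app (lam M) N)     = subst (β-sub (develop N)) (develop M)
develop (app (app L M) N)   = app (develop (app L M)) (develop N)

-- Takahashi's triangle property: `develop M` contracts every redex present in `M`, so a parallel
-- step contracting only some of them can be completed to it. `strip` uses `develop M` as the common
-- reduct.
⇛-develop : ∀ {M N} → M ⇛ N → N ⇛ develop M
⇛-develop var                         = var
⇛-develop (lam r)                     = lam (⇛-develop r)
⇛-develop (app {var _} var t)         = app var (⇛-develop t)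
⇛-develop (app {lam _} (lam r) t)     = β (⇛-develop r) (⇛-develop t)
⇛-develop (app {app _ _} r t)         = app (⇛-develop r) (⇛-develop t)
⇛-develop (β r t)                     = ⇛-subst (⇛-β-sub (⇛-develop t)) (⇛-develop r)

infix 4 _⇛*_

_⇛*_ : Tm → Tm → Set
_⇛*_ = Star _⇛_

strip : ∀ {M N L} → M ⇛ N → M ⇛* L → ∃ λ K → N ⇛* K × L ⇛ K
strip r ε        = _ , ε , r
strip r (t ◅ ts) with strip (⇛-develop t) ts
... | K , us , u = K , ⇛-develop r ◅ us , u

confluence : ∀ {M N L} → M ⇛* N → M ⇛* L → ∃ λ K → N ⇛* K × L ⇛* K
confluence ε        ts = _ , ts , ε
confluence (r ◅ rs) ts with strip r ts
... | K , us , u with confluence rs us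
...   | K' , vs , vs' = K' , vs , u ◅ vs'

church-rosser : ∀ {M N} → M =β N → ∃ λ K → M ⇛* K × N ⇛* K
church-rosser (step r) = _ , →β⇒⇛ r ◅ ε , ε
church-rosser refl     = _ , ε , ε
church-rosser (sym e) with church-rosser e
... | K , rs , ts = K , ts , rs
church-rosser (trans e f) with church-rosser e | church-rosser f
... | K , rs , ts | K' , rs' , ts' with confluence ts rs'
...   | L , us , vs = L , rs ◅◅ us , ts' ◅◅ vs

data λI : Tm → Set where
  var : ∀ {k} → λI (var k)
  lam : ∀ {M} → 0 ∈FV M → λI M → λI (lam M)
  app : ∀ {M N} → λI M → λI N → λI (app M N)

λI-rename : ∀ {M} ρ → λI M → λI (rename ρ M)
λI-rename ρ var       = var
λI-rename ρ (lam p l) = lam (∈FV-rename⁺ p) (λI-rename (extR ρ) l)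
λI-rename ρ (app l m) = app (λI-rename ρ l) (λI-rename ρ m)

λI-subst : ∀ {M s} → λI M → (∀ {k} → k ∈FV M → λI (s k)) → λI (subst s M)
λI-subst var       h = h here
λI-subst (lam p l) h = 
  lam (∈FV-subst⁺ p here) (λI-subst l λ { {zero} _ → var ; {suc k} q → λI-rename suc (h (under q)) })
λI-subst (app l m) h = app (λI-subst l (h ∘ left)) (λI-subst m (h ∘ right))

∈FV-⇛⁻ : ∀ {k M M'} → M ⇛ M' → k ∈FV M' → k ∈FV M
∈FV-⇛⁻ var       p         = p
∈FV-⇛⁻ (lam r)   (under p) = under (∈FV-⇛⁻ r p)
∈FV-⇛⁻ (app r t) (left p)  = left (∈FV-⇛⁻ r p)
∈FV-⇛⁻ (app r t) (right p) = right (∈FV-⇛⁻ t p)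
∈FV-⇛⁻ (β {M' = M'} r t) p with ∈FV-subst⁻ M' p
... | zero  , _ , q    = right (∈FV-⇛⁻ t q)
... | suc j , q , here = left (under (∈FV-⇛⁻ r q))

-- In a λI-term the binder of a contracted redex occurs in its body, so the argument survives the
-- step together with its free variables.
∈FV-⇛⁺ : ∀ {k M M'} → λI M → M ⇛ M' → k ∈FV M → k ∈FV M'
∈FV-⇛⁺ l         var       p         = p
∈FV-⇛⁺ (lam _ l) (lam r)   (under p) = under (∈FV-⇛⁺ l r p)
∈FV-⇛⁺ (app l m) (app r t) (left p)  = left (∈FV-⇛⁺ l r p)
∈FV-⇛⁺ (app l m) (app r t) (right p) = right (∈FV-⇛⁺ m t p)
∈FV-⇛⁺ (app (lam q l) m) (β r t) (left (under p)) = ∈FV-subst⁺ (∈FV-⇛⁺ l r p) here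
∈FV-⇛⁺ (app (lam q l) m) (β r t) (right p) = ∈FV-subst⁺ (∈FV-⇛⁺ l r q) (∈FV-⇛⁺ m t p)

λI-⇛ : ∀ {M M'} → λI M → M ⇛ M' → λI M'
λI-⇛ l         var       = var
λI-⇛ (lam p l) (lam r)   = lam (∈FV-⇛⁺ l r p) (λI-⇛ l r)
λI-⇛ (app l m) (app r t) = app (λI-⇛ l r) (λI-⇛ m t)
λI-⇛ (app (lam p l) m) (β r t) = 
  λI-subst (λI-⇛ l r) λ { {zero} _ → λI-⇛ m t ; {suc k} _ → var }

-- Only leading abstractions are inspected, since reduction never consumes them. This makes the
-- property stable, whereas failing to be a λI-term is not: a vacuous redex may simply be contracted
-- away.
data Erasing : Tm → Set where
  here  : ∀ {M} → ¬ 0 ∈FV M → Erasing (lam M)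
  under : ∀ {M} → Erasing M → Erasing (lam M)

Erasing-⇛ : ∀ {M M'} → Erasing M → M ⇛ M' → Erasing M'
Erasing-⇛ (here p)  (lam r) = here (p ∘ ∈FV-⇛⁻ r)
Erasing-⇛ (under e) (lam r) = under (Erasing-⇛ e r)

Erasing⇒¬λI : ∀ {M} → Erasing M → ¬ λI M
Erasing⇒¬λI (here p)  (lam q _) = p q
Erasing⇒¬λI (under e) (lam _ l) = Erasing⇒¬λI e l

preserved : ∀ {Q : Tm → Set} → (∀ {M M'} → Q M → M ⇛ M' → Q M') → ∀ {M N} → M ⇛* N → Q M → Q N
preserved h ε        q = q
preserved h (r ◅ rs) q = preserved h rs (h q r)

Degenerate : Tm → Set
Degenerate M = ∀ {N} → λI N → M =β N → ⊥

-- By confluence the two terms have a common reduct, which would have to be both erasing and a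
-- λI-term.
Erasing⇒Degenerate : ∀ {M} → Erasing M → Degenerate M
Erasing⇒Degenerate e l eq with church-rosser eq
... | K , rs , ts = Erasing⇒¬λI (preserved Erasing-⇛ rs e) (preserved λI-⇛ ts l)

=β-app : ∀ {M M' N N'} → M =β M' → N =β N' → app M N =β app M' N'
=β-app e f = trans (left-cong e) (right-cong f)
  where
  left-cong : ∀ {M M' N} → M =β M' → app M N =β app M' N
  left-cong (step r)    = step (ξappˡ r)
  left-cong refl        = refl
  left-cong (sym e)     = sym (left-cong e)
  left-cong (trans e f) = trans (left-cong e) (left-cong f)
  right-cong : ∀ {M N N'} → N =β N' → app M N =β app M N'
  right-cong (step r)    = step (ξappʳ r)
  right-cong refl        = refl
  right-cong (sym e)     = sym (right-cong e)
  right-cong (trans e f) = trans (right-cong e) (right-cong f)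

=β-lam : ∀ {M M'} → M =β M' → lam M =β lam M'
=β-lam (step r)    = step (ξlam r)
=β-lam refl        = refl
=β-lam (sym e)     = sym (=β-lam e)
=β-lam (trans e f) = trans (=β-lam e) (=β-lam f)

→β-rename : ∀ {M M'} ρ → M →β M' → rename ρ M →β rename ρ M'
→β-rename ρ (β {M}) = Eq.subst (app (lam (rename (extR ρ) M)) _ →β_) (Eq.sym (rename-β M)) β
→β-rename ρ (ξlam r)  = ξlam (→β-rename (extR ρ) r)
→β-rename ρ (ξappˡ r) = ξappˡ (→β-rename ρ r)
→β-rename ρ (ξappʳ r) = ξappʳ (→β-rename ρ r)

=β-rename : ∀ {M M'} ρ → M =β M' → rename ρ M =β rename ρ M'
=β-rename ρ (step r)    = step (→β-rename ρ r)
=β-rename ρ refl        = refl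
=β-rename ρ (sym e)     = sym (=β-rename ρ e)
=β-rename ρ (trans e f) = trans (=β-rename ρ e) (=β-rename ρ f)

=β-subst : ∀ {s s'} M → (∀ k → s k =β s' k) → subst s M =β subst s' M
=β-subst (var k)   h = h k
=β-subst (lam M)   h = =β-lam (=β-subst M λ where
  zero    → refl
  (suc k) → =β-rename suc (h k))
=β-subst (app M N) h = =β-app (=β-subst M h) (=β-subst N h)

-- Linear typing

≡ᵇ-refl : ∀ x → (x ≡ᵇ x) ≡ true
≡ᵇ-refl x = dec-true (x ℕ.≟ x) refl

≢⇒≡ᵇ-false : ∀ {x y} → x ≢ y → (x ≡ᵇ y) ≡ false
≢⇒≡ᵇ-false {x} {y} = dec-false (x ℕ.≟ y)

if-same : ∀ {A : Set} {a b : A} x → (if x ≡ᵇ x then a else b) ≡ a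
if-same x rewrite ≡ᵇ-refl x = refl

if-diff : ∀ {A : Set} {a b : A} k x → k ≢ x → (if k ≡ᵇ x then a else b) ≡ b
if-diff k x k≢x rewrite ≢⇒≡ᵇ-false k≢x = refl

≡ᵇ-true⁻ : ∀ {x y} → (x ≡ᵇ y) ≡ true → x ≡ y
≡ᵇ-true⁻ {x} {y} e = ℕ.≡ᵇ⇒≡ x y (Eq.subst T (Eq.sym e) _)

&-true : ∀ b {h} → b & h ≡ true → b ≡ true × h ≡ true
&-true true refl = refl , refl

&-not : ∀ b h → b & h ≡ true → b & not h ≡ false
&-not true true refl = refl

&-not′ : ∀ b h → b & not h ≡ true → b & h ≡ false
&-not′ true false refl = refl

&-implied : ∀ b {h} → (b ≡ true → h ≡ true) → b & h ≡ b
&-implied false f = refl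
&-implied true  f = f refl

-- Lets a flag skip a level: with `b & h` the flag of a subterm that receives `ext` exactly when `h`
-- holds, the flag passed on to variable `k` is the same as if it came directly from the whole term.
&-absorb : ∀ b {h} o k → (o ≡ k → h ≡ true) → (b & h) & (o ≡ᵇ k) ≡ b & (o ≡ᵇ k)
&-absorb false     o k f = refl
&-absorb true {h} o k f with o ℕ.≟ k
... | yes o≡k rewrite f o≡k = refl
... | no o≢k rewrite ≢⇒≡ᵇ-false o≢k = ∧-zeroʳ h

just≢nothing : ∀ {A B : Set} {m : Maybe A} {a} → m ≡ just a → m ≡ nothing → B
just≢nothing refl ()

Split-swap : ∀ {Γ Γ₁ Γ₂} → Split Γ Γ₁ Γ₂ → Split Γ Γ₂ Γ₁
Split-swap sp k with sp k
... | inj₁ p = inj₂ p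
... | inj₂ p = inj₁ p

Split-left : ∀ {Γ Γ₁ Γ₂ k σ} → Split Γ Γ₁ Γ₂ → Γ₁ k ≡ just σ → Γ k ≡ just σ × Γ₂ k ≡ nothing
Split-left {k = k} sp e with sp k
... | inj₁ (e' , _)  = just≢nothing e e'
... | inj₂ (n , e')  = Eq.trans e' e , n

Split-right : ∀ {Γ Γ₁ Γ₂ k σ} → Split Γ Γ₁ Γ₂ → Γ₂ k ≡ just σ → Γ k ≡ just σ × Γ₁ k ≡ nothing
Split-right sp = Split-left (Split-swap sp)

Split-other : ∀ {Γ Γ₁ Γ₂ k σ} → Split Γ Γ₁ Γ₂ → Γ k ≡ just σ → Γ₁ k ≡ nothing → ∃ λ τ → Γ₂ k ≡ just τ
Split-other {k = k} sp e n with sp k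
... | inj₁ (_ , e') = _ , Eq.trans (Eq.sym e') e
... | inj₂ (_ , e') = just≢nothing e (Eq.trans e' n)

-- There is no weakening: axioms have singleton environments. Together with `FV⇒dom` this makes the
-- domain of an environment exactly the set of free variables of the term. For `∨E`, variables of
-- `N` reach `M [ N / x ]` because `x` is in the environment of `M` and so occurs there.
dom⇒FV : ∀ {Γ M ρ k σ} → Γ ⊢ M ∶ ρ → Γ k ≡ just σ → k ∈FV M
dom⇒FV {k = k} (ax {x = x} _ none) e with k ℕ.≟ x
... | yes refl = here
... | no k≢x   = just≢nothing e (none k k≢x)
dom⇒FV (⇒I d) e = under (dom⇒FV d e)
dom⇒FV {k = k} (⇒E sp d d') e with sp k
... | inj₁ (_ , e') = right (dom⇒FV d' (Eq.trans (Eq.sym e') e))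
... | inj₂ (_ , e') = left (dom⇒FV d (Eq.trans (Eq.sym e') e))
dom⇒FV (∧I d _) e = dom⇒FV d e
dom⇒FV (∧E₁ d) e = dom⇒FV d e
dom⇒FV (∧E₂ d) e = dom⇒FV d e
dom⇒FV (∨I₁ d) e = dom⇒FV d e
dom⇒FV (∨I₂ d) e = dom⇒FV d e
dom⇒FV {k = k} (∨E {x = x} {N = N} x∉ sp d _ d') e with sp k
... | inj₁ (_ , e') = ∈FV-subst⁺ {j = x} (dom⇒FV d (if-same x))
  (Eq.subst (k ∈FV_) (Eq.sym (if-same x)) (dom⇒FV d' (Eq.trans (Eq.sym e') e)))
... | inj₂ (_ , e') = ∈FV-subst⁺ (dom⇒FV d (Eq.trans (if-diff k x k≢x) e₁))
  (Eq.subst (k ∈FV_) (Eq.sym (if-diff k x k≢x)) here)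
  where
  e₁ = Eq.trans (Eq.sym e') e
  k≢x : k ≢ x
  k≢x refl = just≢nothing e₁ x∉

FV⇒dom : ∀ {Γ M ρ k} → Γ ⊢ M ∶ ρ → k ∈FV M → ∃ λ σ → Γ k ≡ just σ
FV⇒dom (ax e _) here = _ , e
FV⇒dom (⇒I d) (under p) = FV⇒dom d p
FV⇒dom (⇒E sp d _) (left p) = map₂ (proj₁ ∘ Split-left sp) (FV⇒dom d p)
FV⇒dom (⇒E sp _ d) (right p) = map₂ (proj₁ ∘ Split-right sp) (FV⇒dom d p)
FV⇒dom (∧I d _) p = FV⇒dom d p
FV⇒dom (∧E₁ d) p = FV⇒dom d p
FV⇒dom (∧E₂ d) p = FV⇒dom d p
FV⇒dom (∨I₁ d) p = FV⇒dom d p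
FV⇒dom (∨I₂ d) p = FV⇒dom d p
FV⇒dom {k = k} (∨E {x = x} {M = M} {N = N} x∉ sp d _ d') p with ∈FV-subst⁻ M p
... | j , q , r with j ℕ.≟ x
...   | yes refl = map₂ (proj₁ ∘ Split-right sp) (FV⇒dom d' (Eq.subst (k ∈FV_) (if-same x) r))
...   | no j≢x with Eq.subst (k ∈FV_) (if-diff j x j≢x) r
...     | here = map₂ (λ e → proj₁ (Split-left sp (Eq.trans (Eq.sym (if-diff j x j≢x)) e))) (FV⇒dom d q)

Split-≗ : ∀ {Γ Δ Γ₁ Γ₂} → Γ ≗ Δ → Split Γ Γ₁ Γ₂ → Split Δ Γ₁ Γ₂
Split-≗ h sp k with sp k
... | inj₁ (n , e) = inj₁ (n , Eq.trans (Eq.sym (h k)) e)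
... | inj₂ (n , e) = inj₂ (n , Eq.trans (Eq.sym (h k)) e)

⊢-≗ : ∀ {Γ Δ M ρ} → Γ ≗ Δ → Γ ⊢ M ∶ ρ → Δ ⊢ M ∶ ρ
⊢-≗ h (ax e none) =
  ax (Eq.trans (Eq.sym (h _)) e) (λ k k≢x → Eq.trans (Eq.sym (h k)) (none k k≢x))
⊢-≗ h (⇒I d) = ⇒I (⊢-≗ (λ { zero → refl ; (suc k) → h k }) d)
⊢-≗ h (⇒E sp d d') = ⇒E (Split-≗ h sp) d d'
⊢-≗ h (∧I d d') = ∧I (⊢-≗ h d) (⊢-≗ h d')
⊢-≗ h (∧E₁ d) = ∧E₁ (⊢-≗ h d)
⊢-≗ h (∧E₂ d) = ∧E₂ (⊢-≗ h d)
⊢-≗ h (∨I₁ d) = ∨I₁ (⊢-≗ h d)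
⊢-≗ h (∨I₂ d) = ∨I₂ (⊢-≗ h d)
⊢-≗ h (∨E x∉ sp d₁ d₂ d') = ∨E x∉ (Split-≗ h sp) d₁ d₂ d'

-- An environment is a function of the new index, so a renaming acts on it through an inverse. The
-- inverse is partial: indices outside the image must be undeclared, as axioms tolerate no extra
-- declarations.
pull : (ℕ → Maybe ℕ) → Env → Env
pull r Γ j = maybe Γ nothing (r j)

record PartialInverse (ρ : Ren) (r : ℕ → Maybe ℕ) : Set where
  field
    defined : ∀ k → r (ρ k) ≡ just k
    section : ∀ j k → r j ≡ just k → ρ k ≡ j

open PartialInverse

extP : (ℕ → Maybe ℕ) → ℕ → Maybe ℕ
extP r zero    = just zero
extP r (suc j) = Maybe.map suc (r j)

PartialInverse-ext : ∀ {ρ r} → PartialInverse ρ r → PartialInverse (extR ρ) (extP r)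
PartialInverse-ext i .defined zero = refl
PartialInverse-ext i .defined (suc k) rewrite i .defined k = refl
PartialInverse-ext i .section zero .zero refl = refl
PartialInverse-ext {r = r} i .section (suc j) k e with r j in eq
PartialInverse-ext {r = r} i .section (suc j) .(suc k) refl | just k = cong suc (i .section j k eq)

Split-pull : ∀ {Γ Γ₁ Γ₂} r → Split Γ Γ₁ Γ₂ → Split (pull r Γ) (pull r Γ₁) (pull r Γ₂)
Split-pull r sp j with r j
... | nothing = inj₁ (refl , refl)
... | just k  = sp k

pull-∷ : ∀ {r σ Γ} → pull (extP r) (σ ∷ₑ Γ) ≗ σ ∷ₑ pull r Γ
pull-∷ zero = refl
pull-∷ {r} (suc j) with r j
... | nothing = refl
... | just _  = refl

pull-defined : ∀ {ρ r} → PartialInverse ρ r → ∀ Γ k → pull r Γ (ρ k) ≡ Γ k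
pull-defined i Γ k = cong (maybe Γ nothing) (i .defined k)

pull-update : ∀ {ρ r} → PartialInverse ρ r → ∀ {x σ Γ} → pull r (Γ [ x ≔ σ ]) ≗ pull r Γ [ ρ x ≔ σ ]
pull-update {ρ} {r} i {x} {σ} {Γ} j with j ℕ.≟ ρ x
... | yes refl = Eq.trans (pull-defined i (Γ [ x ≔ σ ]) x)
  (Eq.trans (if-same x) (Eq.sym (if-same (ρ x))))
... | no j≢ρx = Eq.trans other (Eq.sym (if-diff j (ρ x) j≢ρx))
  where
  other : pull r (Γ [ x ≔ σ ]) j ≡ pull r Γ j
  other with r j in eq
  ... | nothing = refl
  ... | just k  = if-diff k x λ { refl → j≢ρx (Eq.sym (i .section j k eq)) }

rename-[/] : ∀ {ρ r} → PartialInverse ρ r → ∀ {N x} M →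
  rename ρ (M [ N / x ]) ≡ rename ρ M [ rename ρ N / ρ x ]
rename-[/] {ρ} {r} i {N} {x} M = Eq.trans
  (Eq.trans (rename-subst M) (subst-ext M pointwise))
  (Eq.sym (subst-rename M))
  where
  pointwise : ∀ k → rename ρ (if k ≡ᵇ x then N else var k)
                  ≡ (if ρ k ≡ᵇ ρ x then rename ρ N else var (ρ k))
  pointwise k with k ℕ.≟ x
  ... | yes refl = Eq.trans (cong (rename ρ) (if-same x)) (Eq.sym (if-same (ρ x)))
  ... | no k≢x   = Eq.trans (cong (rename ρ) (if-diff k x k≢x)) (Eq.sym (if-diff (ρ k) (ρ x) λ e →
    k≢x (just-injective (Eq.trans (Eq.sym (i .defined k)) (Eq.trans (cong r e) (i .defined x))))))

⊢-rename : ∀ {ρ r} → PartialInverse ρ r → ∀ {Γ M σ} → Γ ⊢ M ∶ σ → pull r Γ ⊢ rename ρ M ∶ σ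
⊢-rename {ρ} {r} i {Γ} (ax {x = x} e none) = ax (Eq.trans (pull-defined i Γ x) e) others
  where
  others : ∀ j → j ≢ ρ x → pull r Γ j ≡ nothing
  others j j≢ρx with r j in eq
  ... | nothing = refl
  ... | just k  = none k λ { refl → j≢ρx (Eq.sym (i .section j k eq)) }
⊢-rename i (⇒I d) = ⇒I (⊢-≗ pull-∷ (⊢-rename (PartialInverse-ext i) d))
⊢-rename {r = r} i (⇒E sp d d') = ⇒E (Split-pull r sp) (⊢-rename i d) (⊢-rename i d')
⊢-rename i (∧I d d') = ∧I (⊢-rename i d) (⊢-rename i d')
⊢-rename i (∧E₁ d) = ∧E₁ (⊢-rename i d)
⊢-rename i (∧E₂ d) = ∧E₂ (⊢-rename i d)
⊢-rename i (∨I₁ d) = ∨I₁ (⊢-rename i d)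
⊢-rename i (∨I₂ d) = ∨I₂ (⊢-rename i d)
⊢-rename {r = r} i (∨E {Γ₁ = Γ₁} {x = x} {M = M} x∉ sp d₁ d₂ d') =
  Eq.subst (_ ⊢_∶ _) (Eq.sym (rename-[/] i M))
    (∨E (Eq.trans (pull-defined i Γ₁ x) x∉) (Split-pull r sp)
      (⊢-≗ (pull-update i) (⊢-rename i d₁)) (⊢-≗ (pull-update i) (⊢-rename i d₂)) (⊢-rename i d'))

-- Typed linear substitutions and the substitution lemma

infixl 9 _↾_at_

_↾_at_ : Env → Ren → ℕ → Env
(Δ ↾ own at k) j = if own j ≡ᵇ k then Δ j else nothing

↾-at : ∀ own Δ k j → own j ≡ k → (Δ ↾ own at k) j ≡ Δ j
↾-at own Δ .(own j) j refl = if-same (own j)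

↾-off : ∀ own Δ k j → own j ≢ k → (Δ ↾ own at k) j ≡ nothing
↾-off own Δ k j = if-diff (own j) k

↾-empty : ∀ own Δ k j → Δ j ≡ nothing → (Δ ↾ own at k) j ≡ nothing
↾-empty own Δ k j e with own j ℕ.≟ k
... | yes ≡k = Eq.trans (↾-at own Δ k j ≡k) e
... | no ≢k  = ↾-off own Δ k j ≢k

-- Linearity: every variable of Δ has exactly one owner k in Γ, the one variable
-- whose image s k uses it.
record _∶_⇒ₛ_ (s : Sub) (Γ Δ : Env) : Set where
  field
    own   : ℕ → ℕ
    typed : ∀ {k σ} → Γ k ≡ just σ → Δ ↾ own at k ⊢ s k ∶ σ
    owned : ∀ {j τ} → Δ j ≡ just τ → ∃ λ σ → Γ (own j) ≡ just σ

open _∶_⇒ₛ_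

unowned : ∀ {s Γ Δ} (S : s ∶ Γ ⇒ₛ Δ) j → Γ (S .own j) ≡ nothing → Δ j ≡ nothing
unowned {Δ = Δ} S j n with Δ j in eq
... | nothing = refl
... | just _  = just≢nothing (proj₂ (S .owned eq)) n

⇒ₛ-ext : ∀ {s Γ Δ σ} → s ∶ Γ ⇒ₛ Δ → extS s ∶ (σ ∷ₑ Γ) ⇒ₛ (σ ∷ₑ Δ)
⇒ₛ-ext {s} {Γ} {Δ} {σ} S = record { own = extR (S .own) ; typed = typed' ; owned = λ {j} → owned' {j} }
  where
  unsuc : ℕ → Maybe ℕ
  unsuc zero    = nothing
  unsuc (suc j) = just j
  inverse : PartialInverse suc unsuc
  inverse .defined k = refl
  inverse .section (suc j) .j refl = refl
  typed' : ∀ {k τ} → (σ ∷ₑ Γ) k ≡ just τ → (σ ∷ₑ Δ) ↾ extR (S .own) at k ⊢ extS s k ∶ τ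
  typed' {zero} refl = ax refl λ where
    zero    0≢0 → ⊥-elim (0≢0 refl)
    (suc j) _   → refl
  typed' {suc k} e =
    ⊢-≗ (λ { zero → refl ; (suc j) → refl }) (⊢-rename inverse (S .typed e))
  owned' : ∀ {j τ} → (σ ∷ₑ Δ) j ≡ just τ → ∃ λ τ' → (σ ∷ₑ Γ) (extR (S .own) j) ≡ just τ'
  owned' {zero}  _ = _ , refl
  owned' {suc j} e = S .owned e

owned-by : (ℕ → ℕ) → Env → Env → Env
owned-by own Γ Δ j = if is-just (Γ (own j)) then Δ j else nothing

is-just-≡ : ∀ {A : Set} {m : Maybe A} {a} → m ≡ just a → is-just m ≡ true
is-just-≡ refl = refl

is-just⁻ : ∀ {A : Set} {m : Maybe A} → is-just m ≡ true → ∃ λ a → m ≡ just a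
is-just⁻ {m = just a} refl = a , refl

not-is-just⁻ : ∀ {A : Set} {m : Maybe A} → not (is-just m) ≡ true → m ≡ nothing
not-is-just⁻ {m = nothing} refl = refl

owned-by-just : ∀ own Γ {Δ σ} j → Γ (own j) ≡ just σ → owned-by own Γ Δ j ≡ Δ j
owned-by-just own Γ j e rewrite e = refl

owned-by⁻ : ∀ own Γ {Δ τ} j → owned-by own Γ Δ j ≡ just τ →
  (∃ λ σ → Γ (own j) ≡ just σ) × Δ j ≡ just τ
owned-by⁻ own Γ j e with Γ (own j)
... | just σ = (σ , refl) , e

-- Each variable of `Δ` follows its owner to one side. If the owner is on neither side, it is not in
-- `Γ` at all, and then the variable is not in `Δ`.
Split-owned : ∀ {s Γ Γ₁ Γ₂ Δ} (S : s ∶ Γ ⇒ₛ Δ) → Split Γ Γ₁ Γ₂ →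
  Split Δ (owned-by (S .own) Γ₁ Δ) (owned-by (S .own) Γ₂ Δ)
Split-owned {Γ = Γ} {Γ₁} {Γ₂} {Δ} S sp j with Γ₁ (S .own j) in e₁ | Γ₂ (S .own j) in e₂
... | just _  | nothing = inj₂ (refl , refl)
... | nothing | just _  = inj₁ (refl , refl)
... | just _  | just _  = just≢nothing e₂ (proj₂ (Split-left sp e₁))
... | nothing | nothing = inj₁ (refl , unowned S j Γ≡nothing)
  where
  Γ≡nothing : Γ (S .own j) ≡ nothing
  Γ≡nothing with sp (S .own j)
  ... | inj₁ (_ , e) = Eq.trans e e₂
  ... | inj₂ (_ , e) = Eq.trans e e₁

⇒ₛ-left : ∀ {s Γ Γ₁ Γ₂ Δ} (S : s ∶ Γ ⇒ₛ Δ) → Split Γ Γ₁ Γ₂ → s ∶ Γ₁ ⇒ₛ owned-by (S .own) Γ₁ Δ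
⇒ₛ-left {s} {Γ} {Γ₁} {Γ₂} {Δ} S sp = record
  { own   = S .own
  ; typed = λ {k} e → ⊢-≗ (restrict e) (S .typed (proj₁ (Split-left sp e)))
  ; owned = λ {j} e → proj₁ (owned-by⁻ (S .own) Γ₁ {Δ} j e)
  }
  where
  restrict : ∀ {k σ} → Γ₁ k ≡ just σ →
    Δ ↾ S .own at k ≗ owned-by (S .own) Γ₁ Δ ↾ S .own at k
  restrict {k} e j with S .own j ℕ.≟ k
  ... | yes refl = cong (if S .own j ≡ᵇ k then_else nothing) (Eq.sym (owned-by-just (S .own) Γ₁ {Δ} j e))
  ... | no ≢k    = Eq.trans (if-diff _ k ≢k) (Eq.sym (if-diff _ k ≢k))

⇒ₛ-right : ∀ {s Γ Γ₁ Γ₂ Δ} (S : s ∶ Γ ⇒ₛ Δ) → Split Γ Γ₁ Γ₂ → s ∶ Γ₂ ⇒ₛ owned-by (S .own) Γ₂ Δ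
⇒ₛ-right S sp = ⇒ₛ-left S (Split-swap sp)

⇒ₛ-update : ∀ {s Γ Δ x z σ} → s ∶ Γ ⇒ₛ Δ → Γ x ≡ nothing → Δ z ≡ nothing →
  (λ k → if k ≡ᵇ x then var z else s k) ∶ Γ [ x ≔ σ ] ⇒ₛ (Δ [ z ≔ σ ])
⇒ₛ-update {s} {Γ} {Δ} {x} {z} {σ} S x∉ z∉ = record
  { own = own' ; typed = typed' ; owned = λ {j} → owned' {j} }
  where
  own' : ℕ → ℕ
  own' j = if j ≡ᵇ z then x else S .own j
  typed' : ∀ {k τ} → (Γ [ x ≔ σ ]) k ≡ just τ →
    (Δ [ z ≔ σ ]) ↾ own' at k ⊢ (if k ≡ᵇ x then var z else s k) ∶ τ
  typed' {k} e with k ℕ.≟ x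
  ... | no k≢x = Eq.subst (_ ⊢_∶ _) (Eq.sym (if-diff k x k≢x))
    (⊢-≗ (λ j → restrict j) (S .typed (Eq.trans (Eq.sym (if-diff k x k≢x)) e)))
    where
    restrict : Δ ↾ S .own at k ≗ (Δ [ z ≔ σ ]) ↾ own' at k
    restrict j with j ℕ.≟ z
    ... | yes refl = Eq.trans (↾-empty (S .own) Δ k j z∉)
      (Eq.sym (↾-off own' (Δ [ z ≔ σ ]) k j λ e → k≢x (Eq.trans (Eq.sym e) (if-same j))))
    ... | no j≢z = cong₂ (λ i m → if i ≡ᵇ k then m else nothing)
      (Eq.sym (if-diff j z j≢z)) (Eq.sym (if-diff j z j≢z))
  ... | yes refl = Eq.subst (_ ⊢_∶ _) (Eq.sym (if-same k))
    (ax (Eq.trans (↾-at own' (Δ [ z ≔ σ ]) k z (if-same z))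
           (Eq.trans (if-same z) (Eq.trans (Eq.sym (if-same k)) e)))
        others)
    where
    others : ∀ j → j ≢ z → ((Δ [ z ≔ σ ]) ↾ own' at k) j ≡ nothing
    others j j≢z with own' j ℕ.≟ k
    ... | no ≢k = ↾-off own' (Δ [ z ≔ σ ]) k j ≢k
    ... | yes ≡k = ↾-empty own' (Δ [ z ≔ σ ]) k j (Eq.trans (if-diff j z j≢z)
      (unowned S j (Eq.trans (cong Γ (Eq.trans (Eq.sym (if-diff j z j≢z)) ≡k)) x∉)))
  owned' : ∀ {j τ} → (Δ [ z ≔ σ ]) j ≡ just τ → ∃ λ τ' → (Γ [ x ≔ σ ]) (own' j) ≡ just τ'
  owned' {j} e with j ℕ.≟ z
  ... | yes refl = σ , Eq.trans (cong (Γ [ x ≔ σ ]) (if-same j)) (if-same x)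
  ... | no j≢z with S .owned (Eq.trans (Eq.sym (if-diff j z j≢z)) e)
  ...   | τ' , e' = τ' , Eq.trans (cong (Γ [ x ≔ σ ]) (if-diff j z j≢z))
    (Eq.trans (if-diff (S .own j) x λ { refl → just≢nothing e' x∉ }) e')

subst-[/] : ∀ {s N x z} M → (∀ {k} → k ∈FV M → k ≢ x → ¬ z ∈FV s k) →
  subst (λ k → if k ≡ᵇ x then var z else s k) M [ subst s N / z ] ≡ subst s (M [ N / x ])
subst-[/] {s} {N} {x} {z} M fr = Eq.trans (subst-subst M)
  (Eq.trans (subst-cong M pointwise) (Eq.sym (subst-subst M)))
  where
  pointwise : ∀ {k} → k ∈FV M →
    (if k ≡ᵇ x then var z else s k) [ subst s N / z ] ≡ subst s (if k ≡ᵇ x then N else var k)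
  pointwise {k} p with k ℕ.≟ x
  ... | yes refl = Eq.trans (cong (_[ subst s N / z ]) (if-same k))
    (Eq.trans (if-same z) (Eq.sym (cong (subst s) (if-same k))))
  ... | no k≢x = Eq.trans (cong (_[ subst s N / z ]) (if-diff k x k≢x))
    (Eq.trans (subst-id (s k) λ {j} q → if-diff j z λ { refl → fr p k≢x q })
      (Eq.sym (cong (subst s) (if-diff k x k≢x))))

-- Induction on the derivation: environments are split along owners, and in the `∨E` case the
-- eliminated variable `x` is first renamed to a fresh `z`, after which `subst-[/]` restores the
-- substituted term.
⊢-subst : ∀ {s Γ Δ M ρ} → Γ ⊢ M ∶ ρ → s ∶ Γ ⇒ₛ Δ → Δ ⊢ subst s M ∶ ρ
⊢-subst {s} {Γ} {Δ} (ax {x = x} e none) S = ⊢-≗ all-owned (S .typed e)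
  where
  all-owned : Δ ↾ S .own at x ≗ Δ
  all-owned j with S .own j ℕ.≟ x
  ... | yes ≡x = ↾-at (S .own) Δ x j ≡x
  ... | no ≢x  = Eq.trans (↾-off (S .own) Δ x j ≢x) (Eq.sym (unowned S j (none (S .own j) ≢x)))
⊢-subst (⇒I d) S = ⇒I (⊢-subst d (⇒ₛ-ext S))
⊢-subst (⇒E sp d d') S =
  ⇒E (Split-owned S sp) (⊢-subst d (⇒ₛ-left S sp)) (⊢-subst d' (⇒ₛ-right S sp))
⊢-subst (∧I d d') S = ∧I (⊢-subst d S) (⊢-subst d' S)
⊢-subst (∧E₁ d) S = ∧E₁ (⊢-subst d S)
⊢-subst (∧E₂ d) S = ∧E₂ (⊢-subst d S)
⊢-subst (∨I₁ d) S = ∨I₁ (⊢-subst d S)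
⊢-subst (∨I₂ d) S = ∨I₂ (⊢-subst d S)
⊢-subst {s} {Δ = Δ} (∨E {Γ₁ = Γ₁} {x = x} {M = M} x∉ sp d₁ d₂ d') S with fresh s M
... | z , fr = Eq.subst (_ ⊢_∶ _) (subst-[/] M λ p _ → fr p)
  (∨E z∉ (Split-owned S sp)
    (⊢-subst d₁ (⇒ₛ-update S₁ x∉ z∉)) (⊢-subst d₂ (⇒ₛ-update S₁ x∉ z∉))
    (⊢-subst d' (⇒ₛ-right S sp)))
  where
  S₁ = ⇒ₛ-left S sp
  Δ₁ = owned-by (S .own) Γ₁ Δ
  -- If `z` were declared, its owner would be a free variable of `M` whose image contains `z`,
  -- against freshness.
  z∉ : Δ₁ z ≡ nothing
  z∉ with Δ₁ z in eq
  ... | nothing = refl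
  ... | just _ with S₁ .owned eq
  ...   | τ , e = ⊥-elim (fr (dom⇒FV d₁ (Eq.trans (if-diff _ x k≢x) e))
                    (dom⇒FV (S₁ .typed e) (Eq.trans (↾-at (S .own) Δ₁ _ z refl) eq)))
    where
    k≢x : S .own z ≢ x
    k≢x ≡x = just≢nothing e (Eq.trans (cong Γ₁ ≡x) x∉)

⊢⇒λI : ∀ {Γ M ρ} → Γ ⊢ M ∶ ρ → λI M
⊢⇒λI (ax _ _)    = var
⊢⇒λI (⇒I d)      = lam (dom⇒FV d refl) (⊢⇒λI d)
⊢⇒λI (⇒E _ d d') = app (⊢⇒λI d) (⊢⇒λI d')
⊢⇒λI (∧I d _)    = ⊢⇒λI d
⊢⇒λI (∧E₁ d)     = ⊢⇒λI d
⊢⇒λI (∧E₂ d)     = ⊢⇒λI d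
⊢⇒λI (∨I₁ d)     = ⊢⇒λI d
⊢⇒λI (∨I₂ d)     = ⊢⇒λI d
⊢⇒λI (∨E {x = x} {N = N} _ _ d _ d') = λI-subst (⊢⇒λI d) (λ {k} _ → λI-if k)
  where
  λI-if : ∀ k → λI (if k ≡ᵇ x then N else var k)
  λI-if k with k ≡ᵇ x
  ... | true  = ⊢⇒λI d'
  ... | false = var

-- Intersecting environments, and the disjuncts of `w`

↾-ax : ∀ {Δ k σ} → Δ k ≡ just σ → Δ ↾ id at k ⊢ var k ∶ σ
↾-ax {Δ} {k} e = ax (Eq.trans (↾-at id Δ k k refl) e) (λ j j≢k → ↾-off id Δ k j j≢k)

-- The identity substitution, typed as a change of assumptions: each variable may be given a type
-- from which its old type is derivable, provided that the domain stays the same.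
⊢-narrow : ∀ {Γ Δ M ρ} → (∀ k {σ} → Γ k ≡ just σ → Δ ↾ id at k ⊢ var k ∶ σ) →
  (∀ k {τ} → Δ k ≡ just τ → ∃ λ σ → Γ k ≡ just σ) → Γ ⊢ M ∶ ρ → Δ ⊢ M ∶ ρ
⊢-narrow {M = M} h g d = Eq.subst (_ ⊢_∶ _) (subst-var M)
  (⊢-subst d record { own = id ; typed = λ {k} → h k ; owned = λ {j} → g j })

∧-env : Env → Env → Env
∧-env Γ₁ Γ₂ k = Maybe.zipWith _∧_ (Γ₁ k) (Γ₂ k)

∧-env⁻ : ∀ Γ₁ Γ₂ k {σ} → ∧-env Γ₁ Γ₂ k ≡ just σ →
  ∃ λ σ₁ → ∃ λ σ₂ → Γ₁ k ≡ just σ₁ × Γ₂ k ≡ just σ₂ × σ ≡ σ₁ ∧ σ₂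
∧-env⁻ Γ₁ Γ₂ k e with Γ₁ k | Γ₂ k
∧-env⁻ Γ₁ Γ₂ k refl | just σ₁ | just σ₂ = σ₁ , σ₂ , refl , refl , refl
∧-env⁻ Γ₁ Γ₂ k ()   | just _  | nothing
∧-env⁻ Γ₁ Γ₂ k ()   | nothing | _

∧-env⁺ : ∀ Γ₁ Γ₂ k {σ₁ σ₂} → Γ₁ k ≡ just σ₁ → Γ₂ k ≡ just σ₂ → ∧-env Γ₁ Γ₂ k ≡ just (σ₁ ∧ σ₂)
∧-env⁺ Γ₁ Γ₂ k e₁ e₂ = cong₂ (Maybe.zipWith _∧_) e₁ e₂

-- Both environments have the free variables of `M` as domain, so the pointwise intersection loses
-- no declaration and narrows to either of them.
⊢-∧-env : ∀ {Γ₁ Γ₂ M ρ₁ ρ₂} → Γ₁ ⊢ M ∶ ρ₁ → Γ₂ ⊢ M ∶ ρ₂ → ∧-env Γ₁ Γ₂ ⊢ M ∶ ρ₁ ∧ ρ₂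
⊢-∧-env {Γ₁} {Γ₂} d₁ d₂ = ∧I
  (⊢-narrow
    (λ k e₁ → ∧E₁ (↾-ax (∧-env⁺ Γ₁ Γ₂ k e₁ (proj₂ (FV⇒dom d₂ (dom⇒FV d₁ e₁))))))
    (λ k e → let σ₁ , _ , e₁ , _ = ∧-env⁻ Γ₁ Γ₂ k e in σ₁ , e₁) d₁)
  (⊢-narrow
    (λ k e₂ → ∧E₂ (↾-ax (∧-env⁺ Γ₁ Γ₂ k (proj₂ (FV⇒dom d₁ (dom⇒FV d₂ e₂))) e₂)))
    (λ k e → let _ , σ₂ , _ , e₂ , _ = ∧-env⁻ Γ₁ Γ₂ k e in σ₂ , e₂) d₂)

-- `⋀` nests to the right, so concatenation corresponds to `∧` only after reassociation, which is
-- carried out by the typing rules.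
⋀-++⁺ : ∀ {Γ M} μ ν → Γ ⊢ M ∶ ⋀ μ ∧ ⋀ ν → Γ ⊢ M ∶ ⋀ (μ ⁺++⁺ ν)
⋀-++⁺ (α ∷ αs) ν d = go α αs (∧E₁ d) (∧E₂ d)
  where
  go : ∀ {Γ M} α αs → Γ ⊢ M ∶ ⋀ (α ∷ αs) → Γ ⊢ M ∶ ⋀ ν → Γ ⊢ M ∶ ⋀ ((α ∷ αs) ⁺++⁺ ν)
  go α []        d d' = ∧I d d'
  go α (γ ∷ αs) d d' = ∧I (∧E₁ d) (go γ αs (∧E₂ d) d')

⋀-++⁻ : ∀ {Γ M} μ ν → Γ ⊢ M ∶ ⋀ (μ ⁺++⁺ ν) → Γ ⊢ M ∶ ⋀ μ × Γ ⊢ M ∶ ⋀ ν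
⋀-++⁻ (α ∷ αs) ν d = go α αs d
  where
  go : ∀ {Γ M} α αs → Γ ⊢ M ∶ ⋀ ((α ∷ αs) ⁺++⁺ ν) → Γ ⊢ M ∶ ⋀ (α ∷ αs) × Γ ⊢ M ∶ ⋀ ν
  go α []        d = ∧E₁ d , ∧E₂ d
  go α (γ ∷ αs) d with go γ αs (∧E₂ d)
  ... | d₁ , d₂ = ∧I (∧E₁ d) d₁ , d₂

w-∧⁻ : ∀ σ τ {κ} → κ ∈ w (σ ∧ τ) →
  ∃ λ μ → ∃ λ ν → μ ∈ w σ × ν ∈ w τ × κ ≡ μ ⁺++⁺ ν
w-∧⁻ σ τ p with ∈-concatMap⁻ (λ μ → map (μ ⁺++⁺_) (w τ)) {xs = w σ} p
... | q with find q
...   | μ , μ∈ , r with ∈-map⁻ (μ ⁺++⁺_) r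
...     | ν , ν∈ , e = μ , ν , μ∈ , ν∈ , e

w-∧⁺ : ∀ σ τ {μ ν} → μ ∈ w σ → ν ∈ w τ → (μ ⁺++⁺ ν) ∈ w (σ ∧ τ)
w-∧⁺ σ τ {μ} μ∈ ν∈ = ∈-concatMap⁺ (λ μ → map (μ ⁺++⁺_) (w τ)) (lose μ∈ (∈-map⁺ (μ ⁺++⁺_) ν∈))

-- Closures and realizability

-- Delayed substitutions.  The constant ext stands for the argument of the permutator;
-- by linearity, in clo M o s it may occur only inside s o.
data Closure : Set where
  ext : Closure
  clo : Tm → ℕ → (ℕ → Closure) → Closure

-- Reading ext back as λe.Z makes it erase its first argument.
eraser : Tm
eraser = lam (var 1)

⌈_⌉ : Closure → Tm
⌈ ext ⌉       = eraser
⌈ clo M _ s ⌉ = subst (λ k → ⌈ s k ⌉) M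

-- The flag h tells whether ext occurs in the function or in the argument.
apply : Bool → Closure → Closure → Closure
apply h c d = clo (app (var 0) (var 1)) (if h then 0 else 1) (c ◂ λ _ → d)

-- The flag b tells whether ext occurs in c.  A closure with ext at its head is not OK, so the
-- realizability argument never has to split a union type that such a closure produces.
OK : Bool → Closure → Set
OK b c = b ≡ true → Degenerate ⌈ c ⌉

OK-=β : ∀ {b c c'} → ⌈ c ⌉ =β ⌈ c' ⌉ → OK b c → OK b c'
OK-=β e ok b l e' = ok b l (trans e e')

module Realizability (μ : BasicInter) where

  infix 3 _⊨_∶_ _⊨_≼_

  -- The pieces are typed separately, and `ext` is typed as a variable of type `⋀ μ` although it
  -- reads back as `eraser`. Requiring `o` in the domain when the flag is true ensures that `ext`
  -- really occurs, so that it can later be abstracted linearly.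
  _⊨_∶_ : Bool → Closure → Ty → Set
  b ⊨ ext       ∶ ρ = b ≡ true × (⋀ μ ∷ₑ ∅ ⊢ var 0 ∶ ρ)
  b ⊨ clo M o s ∶ ρ = ∃ λ Γ → Γ ⊢ M ∶ ρ × (b ≡ true → ∃ λ τ → Γ o ≡ just τ) ×
                        (∀ k {σ} → Γ k ≡ just σ → b & (o ≡ᵇ k) ⊨ s k ∶ σ)

  ⊨-map : ∀ {b ρ ρ'} c → (∀ {Γ M} → Γ ⊢ M ∶ ρ → Γ ⊢ M ∶ ρ') → b ⊨ c ∶ ρ → b ⊨ c ∶ ρ'
  ⊨-map ext         f (b , d)     = b , f d
  ⊨-map (clo _ _ _) f (Γ , d , h) = Γ , f d , h

  ⊨-∧ : ∀ {b ρ ρ'} c → b ⊨ c ∶ ρ → b ⊨ c ∶ ρ' → b ⊨ c ∶ ρ ∧ ρ'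
  ⊨-∧ ext (b , d) (_ , d') = b , ∧I d d'
  ⊨-∧ {b} (clo M o s) (Γ₁ , d₁ , o₁ , h₁) (Γ₂ , d₂ , o₂ , h₂) =
    ∧-env Γ₁ Γ₂ , ⊢-∧-env d₁ d₂ , owner , pieces
    where
    owner : b ≡ true → ∃ λ τ → ∧-env Γ₁ Γ₂ o ≡ just τ
    owner e = _ , ∧-env⁺ Γ₁ Γ₂ o (proj₂ (o₁ e)) (proj₂ (o₂ e))
    pieces : ∀ k {σ} → ∧-env Γ₁ Γ₂ k ≡ just σ → b & (o ≡ᵇ k) ⊨ s k ∶ σ
    pieces k e with ∧-env⁻ Γ₁ Γ₂ k e
    ... | σ₁ , σ₂ , e₁ , e₂ , refl = ⊨-∧ (s k) (h₁ k e₁) (h₂ k e₂)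

  -- A false flag stays false in every piece and excludes `ext`, hence `eraser`, the only source of
  -- vacuous binders.
  ⊨⇒λI : ∀ {ρ} c → false ⊨ c ∶ ρ → λI ⌈ c ⌉
  ⊨⇒λI (clo M o s) (Γ , d , _ , h) =
    λI-subst (⊢⇒λI d) λ {k} p → ⊨⇒λI (s k) (h k (proj₂ (FV⇒dom d p)))

  _⊨_≼_ : Bool → Closure → Closure → Set
  b ⊨ c ≼ c' = ∀ {ρ} → b ⊨ c ∶ ρ → b ⊨ c' ∶ ρ

  apply-≼ : ∀ {t c c'} h d → t & h ⊨ c ≼ c' → t ⊨ apply h c d ≼ apply h c' d
  apply-≼ {t} {c} {c'} h d f (Γ , e , own , g) = Γ , e , own , pieces h f g
    where
    pieces : ∀ h → t & h ⊨ c ≼ c' →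
      (∀ k {σ} → Γ k ≡ just σ → t & ((if h then 0 else 1) ≡ᵇ k) ⊨ (c ◂ λ _ → d) k ∶ σ) →
      ∀ k {σ} → Γ k ≡ just σ → t & ((if h then 0 else 1) ≡ᵇ k) ⊨ (c' ◂ λ _ → d) k ∶ σ
    pieces true  f g zero    e = f (g zero e)
    pieces false f g zero    e = f (g zero e)
    pieces h     f g (suc k) e = g (suc k) e

  -- Carries out one layer of delayed substitution. The piece environments are glued into a single
  -- one, each variable taking its type from the piece that owns it; disjointness of the pieces
  -- makes this a typed linear substitution.
  flatten : ∀ {b o s M} (N : Sub) (own : ℕ → ℕ) → (∀ {k j} → k ∈FV M → j ∈FV N k → own j ≡ k) →
    b ⊨ clo M (own o) (λ k → clo (N k) o s) ≼ clo (subst N M) o s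
  flatten {b} {o} {s} {M} N own disjoint (Γ , d , own-dom , h) = Δ , ⊢-subst d S , owner , pieces
    where
    -- The environment of the `k`-th piece, with `∅` as default for the pieces that `Γ` does not
    -- use.
    part : ∀ k → ∃ λ Θ →
      (∀ {σ} → Γ k ≡ just σ → Θ ⊢ N k ∶ σ ×
        (b & (own o ≡ᵇ k) ≡ true → ∃ λ τ → Θ o ≡ just τ) ×
        (∀ j {τ} → Θ j ≡ just τ → (b & (own o ≡ᵇ k)) & (o ≡ᵇ j) ⊨ s j ∶ τ)) ×
      (∀ {j τ} → Θ j ≡ just τ → ∃ λ σ → Γ k ≡ just σ)
    part k with Γ k in e
    ... | just σ with h k e
    ...   | Θ , p = Θ , (λ { refl → p }) , λ _ → σ , refl
    part k | nothing = ∅ , (λ ()) , λ ()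
    Δ : Env
    Δ j = proj₁ (part (own j)) j
    Δ-dom : ∀ {j τ} → Δ j ≡ just τ → ∃ λ σ → Γ (own j) ≡ just σ
    Δ-dom {j} = proj₂ (proj₂ (part (own j)))
    restrict : ∀ {k σ} → Γ k ≡ just σ → proj₁ (part k) ≗ Δ ↾ own at k
    restrict {k} e j with own j ℕ.≟ k
    ... | yes refl = Eq.sym (↾-at own Δ k j refl)
    ... | no ≢k with proj₁ (part k) j in eq
    ...   | nothing = Eq.sym (↾-off own Δ k j ≢k)
    ...   | just _  = ⊥-elim (≢k (disjoint (dom⇒FV d e) (dom⇒FV (proj₁ (proj₁ (proj₂ (part k)) e)) eq)))
    S : N ∶ Γ ⇒ₛ Δ
    S = record
      { own   = own
      ; typed = λ {k} e → ⊢-≗ (restrict e) (proj₁ (proj₁ (proj₂ (part k)) e))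
      ; owned = Δ-dom
      }
    owner : b ≡ true → ∃ λ τ → Δ o ≡ just τ
    owner refl = proj₁ (proj₂ (proj₁ (proj₂ (part (own o))) (proj₂ (own-dom refl)))) (≡ᵇ-refl (own o))
    pieces : ∀ j {τ} → Δ j ≡ just τ → b & (o ≡ᵇ j) ⊨ s j ∶ τ
    pieces j {τ} e = Eq.subst (_⊨ s j ∶ τ) (&-absorb b o j λ { refl → ≡ᵇ-refl (own o) })
      (proj₂ (proj₂ (proj₁ (proj₂ (part (own j))) (proj₂ (Δ-dom e)))) j e)

  -- At an arrow, `t` and `h` record whether the application contains `ext` and whether it sits in
  -- the function. The third component treats the argument `ext` separately: a typing of
  -- `apply false c ext` does not directly yield an arrow typing of `c`, so one is demanded here,
  -- and it is produced where `c` is an abstraction.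
  R : Bool → Closure → Ty → Set
  R b c (atom a) = b ⊨ c ∶ atom a
  R b c (σ ⇒ τ)  =
    (b ⊨ c ∶ σ ⇒ τ) ×
    (∀ t h d → b ≡ t & h → R (t & not h) d σ → OK t (apply h c d) → R t (apply h c d) τ) ×
    (b ≡ false → OK true (apply false c ext) → μ ∈ w σ →
       ∃ λ ν → ν ∈ w τ × false ⊨ c ∶ ⋀ μ ⇒ ⋀ ν)
  R b c (σ ∧ τ)  = R b c σ × R b c τ
  R b c (σ ∨ τ)  = R b c σ ⊎ R b c τ

  R⇒⊨ : ∀ {b} c ρ → R b c ρ → b ⊨ c ∶ ρ
  R⇒⊨ c (atom a) r        = r
  R⇒⊨ c (σ ⇒ τ)  (r , _)  = r
  R⇒⊨ c (σ ∧ τ)  (r , r') = ⊨-∧ c (R⇒⊨ c σ r) (R⇒⊨ c τ r')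
  R⇒⊨ c (σ ∨ τ)  (inj₁ r) = ⊨-map c ∨I₁ (R⇒⊨ c σ r)
  R⇒⊨ c (σ ∨ τ)  (inj₂ r) = ⊨-map c ∨I₂ (R⇒⊨ c τ r)

  -- The sum in the realizer chooses the disjunct at each union; at `∧` the two choices are
  -- concatenated, as in the distributive law defining `w`.
  R⇒w : ∀ {b} c ρ → R b c ρ → ∃ λ ν → ν ∈ w ρ × b ⊨ c ∶ ⋀ ν
  R⇒w c (atom a) r        = _ , here refl , r
  R⇒w c (σ ⇒ τ)  (r , _)  = _ , here refl , r
  R⇒w c (σ ∧ τ)  (r , r') with R⇒w c σ r | R⇒w c τ r'
  ... | κ , κ∈ , e | ν , ν∈ , e' =
    κ ⁺++⁺ ν , w-∧⁺ σ τ κ∈ ν∈ , ⊨-map c (⋀-++⁺ κ ν) (⊨-∧ c e e')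
  R⇒w c (σ ∨ τ)  (inj₁ r) = map₂ (λ (ν∈ , e) → ∈-++⁺ˡ ν∈ , e) (R⇒w c σ r)
  R⇒w c (σ ∨ τ)  (inj₂ r) = map₂ (λ (ν∈ , e) → ∈-++⁺ʳ (w σ) ν∈ , e) (R⇒w c τ r)

  -- Closure under expansion steps of the machine. Typings are carried forward along `≼`, while the
  -- `OK` hypotheses go back along conversion of the read-back terms.
  R-≼ : ∀ {b} c c' ρ → b ⊨ c ≼ c' → ⌈ c ⌉ =β ⌈ c' ⌉ → R b c ρ → R b c' ρ
  R-≼ c c' (atom a) f e r = f r
  R-≼ {b} c c' (σ ⇒ τ) f e (r , app-r , ext-r) = f r , app-r' , ext-r'
    where
    app-r' : ∀ t h d → b ≡ t & h → R (t & not h) d σ → OK t (apply h c' d) → R t (apply h c' d) τ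
    app-r' t h d refl r' ok = R-≼ (apply h c d) (apply h c' d) τ (apply-≼ {c' = c'} h d f) e'
      (app-r t h d refl r' (OK-=β {c = apply h c' d} {apply h c d} (sym e') ok))
      where
      e' : ⌈ apply h c d ⌉ =β ⌈ apply h c' d ⌉
      e' = =β-app e refl
    ext-r' : b ≡ false → OK true (apply false c' ext) → μ ∈ w σ →
      ∃ λ ν → ν ∈ w τ × false ⊨ c' ∶ ⋀ μ ⇒ ⋀ ν
    ext-r' refl ok μ∈ = map₂ (λ (ν∈ , e) → ν∈ , f e)
      (ext-r refl (OK-=β {c = apply false c' ext} {apply false c ext} (=β-app (sym e) refl) ok) μ∈)
  R-≼ c c' (σ ∧ τ) f e (r , r') = R-≼ c c' σ f e r , R-≼ c c' τ f e r'
  R-≼ c c' (σ ∨ τ) f e (inj₁ r) = inj₁ (R-≼ c c' σ f e r)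
  R-≼ c c' (σ ∨ τ) f e (inj₂ r) = inj₂ (R-≼ c c' τ f e r)

  -- The read-back contracts to a variable, which is a λI-term.
  ¬OK-apply-ext : ∀ {d} → ¬ OK true (apply true ext d)
  ¬OK-apply-ext ok = ok refl (var {0}) (step β)

  -- Membership in `w ρ` settles every top-level union. At an arrow the application clause is
  -- vacuous because no application of `ext` is `OK`, and the third clause because the flag is true.
  R-ext : ∀ ρ {κ} → κ ∈ w ρ → ⋀ μ ∷ₑ ∅ ⊢ var 0 ∶ ⋀ κ → R true ext ρ
  R-ext (atom a) (here refl) d = refl , d
  R-ext (σ ⇒ τ)  (here refl) d = (refl , d) ,
    (λ { true true d _ _ ok → ⊥-elim (¬OK-apply-ext {d} ok) }) , λ ()
  R-ext (σ ∧ τ) κ∈ d with w-∧⁻ σ τ κ∈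
  ... | κ₁ , κ₂ , κ₁∈ , κ₂∈ , refl with ⋀-++⁻ κ₁ κ₂ d
  ...   | d₁ , d₂ = R-ext σ κ₁∈ d₁ , R-ext τ κ₂∈ d₂
  R-ext (σ ∨ τ) κ∈ d with ∈-++⁻ (w σ) κ∈
  ... | inj₁ κ∈σ = inj₁ (R-ext σ κ∈σ d)
  ... | inj₂ κ∈τ = inj₂ (R-ext τ κ∈τ d)

  R-var : ∀ {b} o s x ρ → (b ≡ true → o ≡ x) → R (b & (o ≡ᵇ x)) (s x) ρ → R b (clo (var x) o s) ρ
  R-var {b} o s x ρ own r =
    R-≼ (s x) (clo (var x) o s) ρ var-≼ refl (Eq.subst (λ b → R b (s x) ρ) same-flag r)
    where
    same-flag : b & (o ≡ᵇ x) ≡ b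
    same-flag = &-implied b λ e → Eq.subst (λ k → (k ≡ᵇ x) ≡ true) (Eq.sym (own e)) (≡ᵇ-refl x)
    Γ : Ty → Env
    Γ τ = ∅ [ x ≔ τ ]
    var-≼ : b ⊨ s x ≼ clo (var x) o s
    var-≼ {τ} e = Γ τ , ax (if-same x) (λ k → if-diff k x) ,
      (λ b≡true → τ , Eq.trans (cong (Γ τ) (own b≡true)) (if-same x)) , pieces
      where
      pieces : ∀ k {σ} → Γ τ k ≡ just σ → b & (o ≡ᵇ k) ⊨ s k ∶ σ
      pieces k {σ} e' with k ℕ.≟ x
      ... | no k≢x   = just≢nothing e' (if-diff k x k≢x)
      ... | yes refl with Eq.trans (Eq.sym e') (if-same x)
      ...   | refl = Eq.subst (_⊨ s x ∶ τ) (Eq.sym same-flag) e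

  -- Expansion holds because function and argument remain separate pieces: the type of variable 0 in
  -- the body becomes the argument type, and the application itself is just `app (var 0) (var 1)`.
  -- Occurrence of 0 in `M` guarantees that this type exists.
  β-≼ : ∀ {h o s M} t d → 0 ∈FV M →
    t ⊨ clo M (if h then suc o else 0) (d ◂ s) ≼ apply h (clo (lam M) o s) d
  β-≼ {h} {o} {s} {M} t d 0∈M {ρ} (Γ , e , own , g) with FV⇒dom e 0∈M
  ... | σ , e₀ = Δ , ⇒E split (ax refl λ { zero 0≢0 → ⊥-elim (0≢0 refl) ; (suc _) _ → refl })
                       (ax refl λ { zero _ → refl ; (suc zero) 1≢1 → ⊥-elim (1≢1 refl) ; (suc (suc _)) _ → refl })
                   , (λ _ → apply-own h) , pieces
    where
    Δ : Env
    Δ = (σ ⇒ ρ) ∷ₑ (σ ∷ₑ ∅)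
    split : Split Δ ((σ ⇒ ρ) ∷ₑ ∅) (λ { zero → nothing ; (suc k) → (σ ∷ₑ ∅) k })
    split zero    = inj₂ (refl , refl)
    split (suc k) = inj₁ (refl , refl)
    apply-own : ∀ h → ∃ λ τ → Δ (if h then 0 else 1) ≡ just τ
    apply-own true  = _ , refl
    apply-own false = _ , refl
    function : ∀ t h → (t ≡ true → ∃ λ τ → Γ (if h then suc o else 0) ≡ just τ) →
      (∀ k {τ} → Γ k ≡ just τ → t & ((if h then suc o else 0) ≡ᵇ k) ⊨ (d ◂ s) k ∶ τ) →
      t & h ⊨ clo (lam M) o s ∶ σ ⇒ ρ
    function t h own g = Γ ∘ suc , ⇒I (⊢-≗ cons e) , owner t h own , pieces' t h g
      where
      cons : Γ ≗ σ ∷ₑ (Γ ∘ suc)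
      cons zero    = e₀
      cons (suc _) = refl
      owner : ∀ t h → (t ≡ true → ∃ λ τ → Γ (if h then suc o else 0) ≡ just τ) →
        t & h ≡ true → ∃ λ τ → Γ (suc o) ≡ just τ
      owner true true own refl = own refl
      pieces' : ∀ t h →
        (∀ k {τ} → Γ k ≡ just τ → t & ((if h then suc o else 0) ≡ᵇ k) ⊨ (d ◂ s) k ∶ τ) →
        ∀ k {τ} → Γ (suc k) ≡ just τ → (t & h) & (o ≡ᵇ k) ⊨ s k ∶ τ
      pieces' true  true  g k = g (suc k)
      pieces' true  false g k = g (suc k)
      pieces' false h     g k = g (suc k)
    pieces : ∀ k {τ} → Δ k ≡ just τ →
      t & ((if h then 0 else 1) ≡ᵇ k) ⊨ (clo (lam M) o s ◂ λ _ → d) k ∶ τ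
    pieces zero refl = Eq.subst (_⊨ clo (lam M) o s ∶ σ ⇒ ρ) (flag h) (function t h own g)
      where
      flag : ∀ h → t & h ≡ t & ((if h then 0 else 1) ≡ᵇ 0)
      flag true  = refl
      flag false = refl
    pieces (suc zero) refl = Eq.subst (_⊨ d ∶ σ) (flag h) (g 0 e₀)
      where
      flag : ∀ h → t & ((if h then suc o else 0) ≡ᵇ 0) ≡ t & ((if h then 0 else 1) ≡ᵇ 1)
      flag true  = refl
      flag false = refl

  ⌈β⌉ : ∀ {h o s} M d →
    ⌈ apply h (clo (lam M) o s) d ⌉ =β ⌈ clo M (if h then suc o else 0) (d ◂ s) ⌉
  ⌈β⌉ {s = s} M d = Eq.subst (app (lam (subst (extS (λ k → ⌈ s k ⌉)) M)) ⌈ d ⌉ =β_)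
    (Eq.trans (subst-β-extS M) (subst-ext M λ { zero → refl ; (suc k) → refl })) (step β)

  -- Soundness of typing for realizability

  infix 3 _⊩_∶_by_

  _⊩_∶_by_ : Bool → (ℕ → Closure) → Env → ℕ → Set
  b ⊩ s ∶ Γ by o = (b ≡ true → ∃ λ τ → Γ o ≡ just τ) ×
                   (∀ k {σ} → Γ k ≡ just σ → R (b & (o ≡ᵇ k)) (s k) σ)

  ⊩⇒⊨ : ∀ {b o s Γ M ρ} → Γ ⊢ M ∶ ρ → b ⊩ s ∶ Γ by o → b ⊨ clo M o s ∶ ρ
  ⊩⇒⊨ {s = s} {Γ} d (own , r) = Γ , d , own , λ k {σ} e → R⇒⊨ (s k) σ (r k e)

  -- Induction on the derivation. `OK` descends to the components of applications and of `∨E`,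
  -- because a λI-term convertible to the component holding `ext` would give one convertible to the
  -- whole. Results are brought back to the original closure by `R-≼`.
  soundness : ∀ {Γ M ρ b o s} → Γ ⊢ M ∶ ρ → b ⊩ s ∶ Γ by o → OK b (clo M o s) → R b (clo M o s) ρ
  soundness {ρ = ρ} {o = o} {s} (ax {x = x} e none) (own , r) ok = R-var o s x ρ o≡x (r x e)
    where
    o≡x : _ → o ≡ x
    o≡x b≡true with o ℕ.≟ x
    ... | yes e = e
    ... | no o≢x = just≢nothing (proj₂ (own b≡true)) (none o o≢x)
  soundness {Γ} {b = b} {o} {s} (⇒I {M = M} {σ = σ} {τ = τ} e) (own , r) ok =
    ⊩⇒⊨ (⇒I e) (own , r) , app-r , ext-r
    where
    K = clo (lam M) o s
    env : ∀ t h d → b ≡ t & h → R (t & not h) d σ → t ⊩ d ◂ s ∶ σ ∷ₑ Γ by (if h then suc o else 0)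
    env true  true  d refl r' = own , λ { zero refl → r' ; (suc k) e → r k e }
    env true  false d refl r' = (λ _ → σ , refl) , λ { zero refl → r' ; (suc k) e → r k e }
    env false h     d refl r' = (λ ()) , λ { zero refl → r' ; (suc k) e → r k e }
    app-r : ∀ t h d → b ≡ t & h → R (t & not h) d σ → OK t (apply h K d) → R t (apply h K d) τ
    app-r t h d b≡ r' ok' = R-≼ (clo M o' (d ◂ s)) (apply h K d) τ (β-≼ {h} t d (dom⇒FV e refl))
      (sym (⌈β⌉ {h} {o} M d))
      (soundness e (env t h d b≡ r') (OK-=β {c = apply h K d} {clo M o' (d ◂ s)} (⌈β⌉ {h} {o} M d) ok'))
      where
      o' = if h then suc o else 0
    ext-r : b ≡ false → OK true (apply false K ext) → μ ∈ w σ →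
      ∃ λ ν → ν ∈ w τ × false ⊨ K ∶ ⋀ μ ⇒ ⋀ ν
    -- The body is run on `ext`, and its realizer selects `ν`. The typing found gives variable 0 a
    -- type derivable from `⋀ μ`, so narrowing permits `⇒I`; `own'` supplies the declaration of
    -- variable 0.
    ext-r refl ok' μ∈
      with R⇒w (clo M 0 (ext ◂ s)) τ (soundness e (env true false ext refl (R-ext σ μ∈ X))
             (OK-=β {c = apply false K ext} {clo M 0 (ext ◂ s)} (⌈β⌉ {false} {o} M ext) ok'))
      where
      X : ⋀ μ ∷ₑ ∅ ⊢ var 0 ∶ ⋀ μ
      X = ax refl λ { zero 0≢0 → ⊥-elim (0≢0 refl) ; (suc _) _ → refl }
    ... | ν , ν∈ , Γ' , e' , own' , g = ν , ν∈ , Γ' ∘ suc , ⇒I (⊢-narrow narrow total e') , (λ ()) , λ k → g (suc k)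
      where
      narrow : ∀ k {τ'} → Γ' k ≡ just τ' → (⋀ μ ∷ₑ (Γ' ∘ suc)) ↾ id at k ⊢ var k ∶ τ'
      narrow zero    e₀ = ⊢-≗ (λ { zero → refl ; (suc _) → refl }) (proj₂ (g 0 e₀))
      narrow (suc k) eₖ = ↾-ax eₖ
      total : ∀ k {τ'} → (⋀ μ ∷ₑ (Γ' ∘ suc)) k ≡ just τ' → ∃ λ τ' → Γ' k ≡ just τ'
      total zero    _ = own' refl
      total (suc k) e = _ , e
  soundness {Γ} {b = b} {o} {s} (⇒E {Γ₁ = Γ₁} {Γ₂} {K} {L} {σ} {τ} sp d₁ d₂) (own , r) ok =
    R-≼ (apply h (clo K o s) (clo L o s)) (clo (app K L) o s) τ
      collapse refl
      (proj₁ (proj₂ (soundness d₁ env₁ ok₁)) b h (clo L o s) refl (soundness d₂ env₂ ok₂) ok)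
    where
    h = is-just (Γ₁ o)
    -- At `o` this is by computation the index chosen by `apply h`, so `flatten` applies without
    -- transport.
    owner : ℕ → ℕ
    owner j = if is-just (Γ₁ j) then 0 else 1
    N : Sub
    N = K ◂ λ _ → L
    h-true : ∀ {k σ'} → Γ₁ k ≡ just σ' → o ≡ k → h ≡ true
    h-true e refl = is-just-≡ e
    h-false : ∀ {k σ'} → Γ₂ k ≡ just σ' → o ≡ k → not h ≡ true
    h-false e refl = cong (not ∘ is-just) (proj₂ (Split-right sp e))
    env₁ : b & h ⊩ s ∶ Γ₁ by o
    env₁ = (λ e → is-just⁻ (proj₂ (&-true b e))) , λ k {σ'} e →
      Eq.subst (λ b → R b (s k) σ') (Eq.sym (&-absorb b o k (h-true e))) (r k (proj₁ (Split-left sp e)))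
    env₂ : b & not h ⊩ s ∶ Γ₂ by o
    env₂ = own₂ , λ k {σ'} e →
      Eq.subst (λ b → R b (s k) σ') (Eq.sym (&-absorb b o k (h-false e))) (r k (proj₁ (Split-right sp e)))
      where
      own₂ : b & not h ≡ true → ∃ λ τ → Γ₂ o ≡ just τ
      own₂ e = Split-other sp (proj₂ (own (proj₁ (&-true b e)))) (not-is-just⁻ (proj₂ (&-true b e)))
    -- When `ext` is in `K`, the argument `L` is free of it and reads back as a λI-term; hence a
    -- λI-form of `K` would give one of the application.
    ok₁ : OK (b & h) (clo K o s)
    ok₁ bh l e = ok (proj₁ (&-true b bh)) (app l (⊨⇒λI (clo L o s) L-closed)) (=β-app e refl)
      where
      L-closed : false ⊨ clo L o s ∶ σ
      L-closed = Eq.subst (_⊨ clo L o s ∶ σ) (&-not b h bh) (⊩⇒⊨ d₂ env₂)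
    ok₂ : OK (b & not h) (clo L o s)
    ok₂ bh l e = ok (proj₁ (&-true b bh)) (app (⊨⇒λI (clo K o s) K-closed) l) (=β-app refl e)
      where
      K-closed : false ⊨ clo K o s ∶ σ ⇒ τ
      K-closed = Eq.subst (_⊨ clo K o s ∶ σ ⇒ τ) (&-not′ b h bh) (⊩⇒⊨ d₁ env₁)
    disjoint : ∀ {k j} → k ∈FV app (var 0) (var 1) → j ∈FV N k → owner j ≡ k
    disjoint (left here)  p rewrite proj₂ (FV⇒dom d₁ p) = refl
    disjoint (right here) p rewrite proj₂ (Split-right sp (proj₂ (FV⇒dom d₂ p))) = refl
    collapse : b ⊨ apply h (clo K o s) (clo L o s) ≼ clo (app K L) o s
    collapse (Γ' , d , own' , g) = flatten {M = app (var 0) (var 1)} N owner disjoint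
      (Γ' , d , own' , λ { zero → g zero ; (suc k) → g (suc k) })
  soundness (∧I d d') env ok = soundness d env ok , soundness d' env ok
  soundness (∧E₁ d) env ok = proj₁ (soundness d env ok)
  soundness (∧E₂ d) env ok = proj₂ (soundness d env ok)
  soundness (∨I₁ d) env ok = inj₁ (soundness d env ok)
  soundness (∨I₂ d) env ok = inj₂ (soundness d env ok)
  soundness {Γ} {ρ = ρ} {b} {o} {s}
    (∨E {Γ₁ = Γ₁} {Γ₂} {x} {M} {N} {σ} {τ} {θ} x∉ sp d₁ d₂ d') (own , r) ok
    = cases (soundness d' env₂ ok₂)
    where
    N' : Sub
    N' k = if k ≡ᵇ x then N else var k
    S : ℕ → Closure
    S k = clo (N' k) o s
    ŝ : Sub
    ŝ k = ⌈ s k ⌉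
    -- The substituted term is viewed as `M` with delayed pieces: variables of `N` are reached
    -- through `x`, all others through themselves.
    owner : ℕ → ℕ
    owner j = if is-just (Γ₂ j) then x else j
    owner₁ : ∀ {j σ'} → Γ₁ j ≡ just σ' → owner j ≡ j
    owner₁ {j} e = cong (λ m → if is-just m then x else j) (proj₂ (Split-left sp e))
    owner₂ : ∀ {j σ'} → Γ₂ j ≡ just σ' → owner j ≡ x
    owner₂ {j} e = cong (λ m → if is-just m then x else j) e
    x∉Γ₁ : ∀ {j σ'} → Γ₁ j ≡ just σ' → j ≢ x
    x∉Γ₁ e refl = just≢nothing e x∉
    o-cases : b ≡ true → (owner o ≡ x × ∃ λ τ → Γ₂ o ≡ just τ) ⊎ (owner o ≡ o × ∃ λ τ → Γ₁ o ≡ just τ)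
    o-cases b≡true with own b≡true
    ... | τ , e with sp o
    ...   | inj₁ (_ , e') = inj₁ (owner₂ (Eq.trans (Eq.sym e') e) , τ , Eq.trans (Eq.sym e') e)
    ...   | inj₂ (_ , e') = inj₂ (owner₁ (Eq.trans (Eq.sym e') e) , τ , Eq.trans (Eq.sym e') e)
    o∈Γ₂ : b & (owner o ≡ᵇ x) ≡ true → ∃ λ τ → Γ₂ o ≡ just τ
    o∈Γ₂ f with &-true b f
    ... | b≡true , o≡ with o-cases b≡true
    ...   | inj₁ (_ , p) = p
    ...   | inj₂ (≡o , _ , e) = ⊥-elim (x∉Γ₁ e (Eq.trans (Eq.sym ≡o) (≡ᵇ-true⁻ o≡)))
    disjoint : ∀ {k j} → k ∈FV M → j ∈FV N' k → owner j ≡ k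
    disjoint {k} {j} p q with k ℕ.≟ x
    ... | yes refl = owner₂ (proj₂ (FV⇒dom d' (Eq.subst (j ∈FV_) (if-same k) q)))
    ... | no k≢x with Eq.subst (j ∈FV_) (if-diff k x k≢x) q
    ...   | here = owner₁ (Eq.trans (Eq.sym (if-diff k x k≢x)) (proj₂ (FV⇒dom d₁ p)))
    env₂ : b & (owner o ≡ᵇ x) ⊩ s ∶ Γ₂ by o
    env₂ = o∈Γ₂ , λ k {σ'} e → Eq.subst (λ b → R b (s k) σ')
      (Eq.sym (&-absorb b o k λ { refl → Eq.trans (cong (_≡ᵇ x) (owner₂ e)) (≡ᵇ-refl x) }))
      (r k (proj₁ (Split-right sp e)))
    -- A λI-term convertible to N would yield one convertible to M [ N / x ].
    ok₂ : OK (b & (owner o ≡ᵇ x)) (clo N o s)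
    ok₂ f {L} l e = ok (proj₁ (&-true b f)) (λI-subst (⊢⇒λI d₁) λI-image)
      (Eq.subst (_=β subst L' M) (Eq.sym (subst-subst M)) (=β-subst M convert))
      where
      L' : Sub
      L' k = if k ≡ᵇ x then L else ŝ k
      convert : ∀ k → subst ŝ (N' k) =β L' k
      convert k with k ≡ᵇ x
      ... | true  = e
      ... | false = refl
      λI-image : ∀ {k} → k ∈FV M → λI (L' k)
      λI-image {k} p with k ℕ.≟ x
      ... | yes refl = Eq.subst λI (Eq.sym (if-same k)) l
      ... | no k≢x = Eq.subst λI (Eq.sym (if-diff k x k≢x)) (⊨⇒λI (s k) closed)
        where
        k∈ : ∃ λ σ' → Γ₁ k ≡ just σ'
        k∈ = map₂ (Eq.trans (Eq.sym (if-diff k x k≢x))) (FV⇒dom d₁ p)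
        o≢k : o ≢ k
        o≢k refl = just≢nothing (proj₂ k∈) (proj₂ (Split-right sp (proj₂ (o∈Γ₂ f))))
        closed : false ⊨ s k ∶ proj₁ k∈
        closed = Eq.subst (_⊨ s k ∶ proj₁ k∈) (Eq.trans (cong (b &_) (≢⇒≡ᵇ-false o≢k)) (∧-zeroʳ b))
          (R⇒⊨ (s k) _ (r k (proj₁ (Split-left sp (proj₂ k∈)))))
    env₁ : ∀ {η} → R (b & (owner o ≡ᵇ x)) (clo N o s) η → b ⊩ S ∶ Γ₁ [ x ≔ η ] by owner o
    env₁ {η} r' = own₁ , pieces
      where
      own₁ : b ≡ true → ∃ λ τ → (Γ₁ [ x ≔ η ]) (owner o) ≡ just τ
      own₁ b≡true with o-cases b≡true
      ... | inj₁ (≡x , _) = η , Eq.trans (cong (Γ₁ [ x ≔ η ]) ≡x) (if-same x)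
      ... | inj₂ (≡o , τ , e) =
        τ , Eq.trans (cong (Γ₁ [ x ≔ η ]) ≡o) (Eq.trans (if-diff o x (x∉Γ₁ e)) e)
      pieces : ∀ k {σ'} → (Γ₁ [ x ≔ η ]) k ≡ just σ' → R (b & (owner o ≡ᵇ k)) (S k) σ'
      pieces k {σ'} e with k ℕ.≟ x
      ... | yes refl with Eq.trans (Eq.sym e) (if-same k)
      ...   | refl = Eq.subst (λ L → R (b & (owner o ≡ᵇ k)) (clo L o s) η) (Eq.sym (if-same k)) r'
      pieces k {σ'} e | no k≢x =
        Eq.subst (λ L → R (b & (owner o ≡ᵇ k)) (clo L o s) σ') (Eq.sym (if-diff k x k≢x))
          (R-var o s k σ' o≡k (Eq.subst (λ b → R b (s k) σ')
            (Eq.sym (&-absorb b o k λ { refl → Eq.trans (cong (_≡ᵇ k) (owner₁ k∈)) (≡ᵇ-refl k) }))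
            (r k (proj₁ (Split-left sp k∈)))))
        where
        k∈ : Γ₁ k ≡ just σ'
        k∈ = Eq.trans (Eq.sym (if-diff k x k≢x)) e
        o≡k : b & (owner o ≡ᵇ k) ≡ true → o ≡ k
        o≡k f with &-true b f
        ... | b≡true , ≡k with o-cases b≡true
        ...   | inj₁ (≡x , _) = ⊥-elim (k≢x (Eq.trans (Eq.sym (≡ᵇ-true⁻ ≡k)) ≡x))
        ...   | inj₂ (≡o , _) = Eq.trans (Eq.sym ≡o) (≡ᵇ-true⁻ ≡k)
    ok₁ : OK b (clo M (owner o) S)
    ok₁ = Eq.subst (λ L → b ≡ true → Degenerate L) (subst-subst M) ok
    collapse : R b (clo M (owner o) S) ρ → R b (clo (M [ N / x ]) o s) ρ
    collapse = R-≼ (clo M (owner o) S) (clo (M [ N / x ]) o s) ρ (flatten N' owner disjoint)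
      (Eq.subst (subst (subst ŝ ∘ N') M =β_) (Eq.sym (subst-subst M)) refl)
    -- The sum in the realizer of `N` decides which premise of `∨E` is followed.
    cases : R (b & (owner o ≡ᵇ x)) (clo N o s) ((σ ∨ τ) ∧ θ) → R b (clo (M [ N / x ]) o s) ρ
    cases (inj₁ r₁ , r') = collapse (soundness d₁ (env₁ {σ ∧ θ} (r₁ , r')) ok₁)
    cases (inj₂ r₂ , r') = collapse (soundness d₂ (env₁ {τ ∧ θ} (r₂ , r')) ok₁)

-- The head of a permutator erases

lams-suc : ∀ n M → lams (suc n) M ≡ lam (lams n M)
lams-suc zero    M = refl
lams-suc (suc n) M = lams-suc n (lam M)

=β-lams : ∀ n {M N} → M =β N → lams n M =β lams n N
=β-lams zero    e = e
=β-lams (suc n) e = =β-lams n (=β-lam e)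

Erasing-lams : ∀ n {M} → Erasing M → Erasing (lams n M)
Erasing-lams zero    e = e
Erasing-lams (suc n) e = Erasing-lams n (under e)

-- Index `k` belongs to one of the `n` binders, the innermost being 0; that binder is vacuous.
lams-erasing : ∀ n {k M} → k < n → ¬ k ∈FV M → Erasing (lams n M)
lams-erasing (suc n) {zero}  _         k∉ = Erasing-lams n (here k∉)
lams-erasing (suc n) {suc k} (s≤s k<n) k∉ = lams-erasing n k<n λ { (under p) → k∉ p }

extSⁿ : ℕ → Sub → Sub
extSⁿ zero    s = s
extSⁿ (suc n) s = extS (extSⁿ n s)

subst-lams : ∀ n {s M} → subst s (lams n M) ≡ lams n (subst (extSⁿ n s) M)
subst-lams zero    = refl
subst-lams (suc n) = subst-lams n

extSⁿ-high : ∀ n s i → extSⁿ n s (n + i) ≡ rename (n +_) (s i)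
extSⁿ-high zero    s i = Eq.sym (Eq.trans (rename≡subst (s i)) (subst-var (s i)))
extSⁿ-high (suc n) s i = Eq.trans (cong (rename suc) (extSⁿ-high n s i)) (rename-rename (s i))

extSⁿ-low : ∀ n s {j} → j < n → extSⁿ n s j ≡ var j
extSⁿ-low (suc n) s {zero}  _         = refl
extSⁿ-low (suc n) s {suc j} (s≤s j<n) = cong (rename suc) (extSⁿ-low n s j<n)

subst-foldl : ∀ {s} M Ns → subst s (foldl app M Ns) ≡ foldl app (subst s M) (map (subst s) Ns)
subst-foldl M []       = refl
subst-foldl M (N ∷ Ns) = subst-foldl (app M N) Ns

=β-foldl : ∀ {M M'} Ns → M =β M' → foldl app M Ns =β foldl app M' Ns
=β-foldl []       e = e
=β-foldl (N ∷ Ns) e = =β-foldl Ns (=β-app e refl)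

∈FV-foldl⁻ : ∀ {k} M Ns → k ∈FV foldl app M Ns → k ∈FV M ⊎ Any (k ∈FV_) Ns
∈FV-foldl⁻ M []       p = inj₁ p
∈FV-foldl⁻ M (N ∷ Ns) p with ∈FV-foldl⁻ (app M N) Ns p
... | inj₁ (left q)  = inj₁ q
... | inj₁ (right q) = inj₂ (here q)
... | inj₂ q         = inj₂ (there q)

Degenerate-=β : ∀ {M N} → M =β N → Degenerate N → Degenerate M
Degenerate-=β e deg l e' = deg l (trans (sym e) e')

-- The erased first argument held the only occurrence of its bound variable: `π` is injective and
-- the `Ps` are shifted past all the binders. With no arguments, `eraser` itself is the result.
permShape-degenerate : ∀ n π Ps → Degenerate (app (permShape n π Ps) eraser)
permShape-degenerate zero π Ps = Degenerate-=β (step β) (Erasing⇒Degenerate (here λ ()))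
permShape-degenerate n@(suc m) π Ps =
  Degenerate-=β reduces (Erasing⇒Degenerate (lams-erasing n (y< zero) erased))
  where
  -- y i is the de Bruijn index of the variable y_{π(i+1)} of the paper.
  y : Fin n → ℕ
  y i = n ∸ suc (toℕ (π ⟨$⟩ʳ i))
  y< : ∀ i → y i < n
  y< i = s≤s (ℕ.m∸n≤m m (toℕ (π ⟨$⟩ʳ i)))
  y-injective : ∀ i j → y i ≡ y j → i ≡ j
  y-injective i j e = Eq.trans (Eq.sym (inverseˡ π)) (Eq.trans (cong (π ⟨$⟩ˡ_)
    (toℕ-injective (ℕ.suc-injective (ℕ.∸-cancelˡ-≡ (toℕ<n (π ⟨$⟩ʳ i)) (toℕ<n (π ⟨$⟩ʳ j)) e))))
    (inverseˡ π))
  arg : Fin n → Tm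
  arg i = app (rename (_+ suc n) (Ps i)) (var (y i))
  s : Sub
  s = extSⁿ n (β-sub eraser)
  rest : List Tm
  rest = map (subst s) (map arg (tabulate suc))
  reduces : app (permShape n π Ps) eraser =β lams n (foldl app (var (n + 0)) rest)
  reduces rewrite lams-suc n (foldl app (var n) (map arg (tabulate id))) =
    trans (step β) (Eq.subst (_=β lams n (foldl app (var (n + 0)) rest)) (Eq.sym (subst-lams n))
      (=β-lams n (Eq.subst (_=β foldl app (var (n + 0)) rest)
        (Eq.sym (subst-foldl (app (var n) (arg zero)) (map arg (tabulate suc))))
        (=β-foldl rest erase))))
    where
    -- Under the `n` binders, `s n` is `eraser` shifted by `n`; its free variable, index 0 outside,
    -- becomes `n + 0`.
    erase : app (s n) (subst s (arg zero)) =β var (n + 0)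
    erase = Eq.subst (λ J → app J (subst s (arg zero)) =β var (n + 0))
      (Eq.sym (Eq.trans (cong s (Eq.sym (ℕ.+-identityʳ n))) (extSⁿ-high n (β-sub eraser) 0))) (step β)
  arg-free : ∀ i → y zero ∈FV subst s (arg (suc i)) → ⊥
  -- A free variable `j` of a permutator sits at `j + suc n` and is sent to `n + j`, whereas
  -- `y zero` is below `n`.
  arg-free i (left p) with ∈FV-subst⁻ (rename (_+ suc n) (Ps (suc i))) p
  ... | _ , q , r with ∈FV-rename⁻ (Ps (suc i)) q
  ...   | j , _ , refl
    with Eq.subst (y zero ∈FV_) (Eq.trans (cong s swap) (extSⁿ-high n (β-sub eraser) (suc j))) r
       | y< zero
    where
    swap : j + suc n ≡ n + suc j
    swap = Eq.trans (ℕ.+-suc j n) (Eq.trans (cong suc (ℕ.+-comm j n)) (Eq.sym (ℕ.+-suc n j)))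
  ...     | r' | y<n with n + j | r' | ℕ.m≤m+n n j
  ...       | _ | here | n≤ = ℕ.<⇒≱ y<n n≤
  arg-free i (right p) with Eq.subst (y zero ∈FV_) (extSⁿ-low n (β-sub eraser) (y< (suc i))) p
  ... | p' = apart (y zero) (y (suc i)) p' (y-injective zero (suc i))
    where
    apart : ∀ k l → k ∈FV var l → (k ≡ l → Fin.zero ≡ suc i) → ⊥
    apart k .k here f with f refl
    ... | ()
  erased : ¬ y zero ∈FV foldl app (var (n + 0)) rest
  erased p with ∈FV-foldl⁻ (var (n + 0)) rest p
  ... | inj₂ q = let i , q' = tabulate⁻ (map⁻ (map⁻ q)) in arg-free i q'
  ... | inj₁ q = apart (n + 0) q (ℕ.m≤m+n n 0)
    where
    apart : ∀ l → y zero ∈FV var l → n ≤ l → ⊥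
    apart _ here n≤ = ℕ.<⇒≱ (y< zero) n≤

-- The disjunct chosen by the permutator

mainTheorem4 : (P : Tm) (σ τ : Ty) → FHP P → ∅ ⊢ P ∶ σ ⇒ τ →
    (μ : BasicInter) → μ ∈ w σ → Σ BasicInter (λ ν → ν ∈ w τ × (∅ ⊢ P ∶ ⋀ μ ⇒ ⋀ ν))
mainTheorem4 P σ τ (fhp n π Ps _ e) d μ μ∈
  -- `P` is closed, so the delayed substitution and the owner 0 are dummies and the flag is false.
  -- The third component of the arrow clause then yields `ν`, given that `P` applied to `eraser` is
  -- degenerate.
  with proj₂ (proj₂ (soundness {b = false} {0} {λ _ → ext} d ((λ ()) , λ _ ()) λ ())) refl ok μ∈
  where
  open Realizability μ
  closed : subst (λ _ → eraser) P ≡ P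
  closed = subst-id P λ p → just≢nothing (proj₂ (FV⇒dom d p)) refl
  ok : OK true (apply false (clo P 0 (λ _ → ext)) ext)
  ok _ = Degenerate-=β (=β-app (Eq.subst (_=β permShape n π Ps) (Eq.sym closed) e) refl)
    (permShape-degenerate n π Ps)
... | ν , ν∈ , Γ , d' , _ = ν , ν∈ , ⊢-≗ empty d'
  where
  empty : Γ ≗ ∅
  -- The realizer types `P` in some `Γ`, whose domain consists of free variables of `P`; the given
  -- typing in `∅` shows that there are none.
  empty k with Γ k in eq
  ... | nothing = refl
  ... | just _ = just≢nothing (proj₂ (FV⇒dom d (dom⇒FV d' eq))) refl
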